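{- Let $q=p^f$ be a power of a prime $p$, let $s<0$ be an integer and $d\ge 0$, and assume $S_d(s)\neq 0$. Write $$S_d(s)=(-1)^d\sum_{(m_0,\ldots,m_d)\in U_d(-s)}\binom{ -s}{m_0,\ldots,m_d}\,t^{\,dm_0+(d-1)m_1+\cdots+m_{d-1}}.$$ Then the summand corresponding to the modest element of $U_d(-s)$ attains the unique minimum degree in $t$ among all summands of this sum; i.e. if $(M_0,\ldots,M_d)$ is the modest element of $U_d(-s)$, then $dM_0+(d-1)M_1+\cdots+M_{d-1}<dm_0+(d-1)m_1+\cdots+m_{d-1}$ for every other $(m_0,\ldots,m_d)\in U_d(-s)$.
   Context: $\mathbb{F}_q$ is the field with $q=p^f$ elements, $A=\mathbb{F}_q[t]$, and $A_{d+}$ is the set of monic polynomials in $A$ of degree $d$. For $d\ge0$ and $s\in\mathbb{Z}$, $S_d(s)=\sum_{a\in A_{d+}}a^{ -s}$; for $s<0$ this lies in $A$. An integer is $q$-even if it is divisible by $q-1$. $\mathbb{N}=\{0,1,2,\ldots\}$. For $k>0$, $d\ge 0$, $U_d(k)$ is the set of $(m_0,\ldots,m_d)\in\mathbb{N}^{d+1}$ such that $k=\sum_i m_i$ with no carry-over of digits in base $p$ (i.e. the base-$p$ digits of the $m_i$ add digitwise, without carries, to those of $k$) and $m_i>0$ is $q$-even for $1\le i\le d$. By expanding $a=t^d+\theta_1t^{d-1}+\cdots+\theta_d$ and using Lucas' theorem one has, for $s<0$, the displayed identity, in which all multinomial coefficients are nonzero modulo $p$. An element $(M_0,\ldots,M_d)\in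 U_d(k)$ is called modest if its reverse $(M_d,M_{d-1},\ldots,M_0)$ is lexicographically the largest among reverses of elements of $U_d(k)$; it exists and is unique whenever $U_d(k)\ne\emptyset$. -}

module Defs where

open import Data.Nat using (ℕ; zero; suc; _+_; _*_; _∸_; _<_)
open import Data.Nat.DivMod using (_/_; _%_)
open import Data.Nat.Divisibility using (_∣_)
open import Data.Fin using (Fin; toℕ) renaming (zero to fzero; suc to fsuc)
open import Data.Vec using (Vec; []; _∷_; lookup; tabulate; sum; reverse)
open import Data.Product using (_×_)
open import Data.Sum using (_⊎_)
open import Relation.Binary.PropositionalEquality using (_≡_)
open import Data.Empty using (⊥)
open import Relation.Nullary using (¬_)

-- j-th base-p digit of n (p = 0 is a junk case, never used since p is prime)
digit : ℕ → ℕ → ℕ → ℕ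
digit zero    j       n = 0
digit (suc b) zero    n = n % suc b
digit (suc b) (suc j) n = digit (suc b) j (n / suc b)

NoCarrySum : (p k : ℕ) {n : ℕ} → Vec ℕ n → Set
NoCarrySum p k m =
  (sum m ≡ k) × (∀ (j : ℕ) → sum (Data.Vec.map (digit p j) m) ≡ digit p j k)

QEven : ℕ → ℕ → Set
QEven q m = (q ∸ 1) ∣ m

InU : (p q d k : ℕ) → Vec ℕ (suc d) → Set
InU p q d k m =
  NoCarrySum p k m × (∀ (i : Fin d) → (0 < lookup m (fsuc i)) × QEven q (lookup m (fsuc i)))

_<lex_ : {n : ℕ} → Vec ℕ n → Vec ℕ n → Set
[] <lex [] = ⊥
(x ∷ xs) <lex (y ∷ ys) = (x < y) ⊎ ((x ≡ y) × (xs <lex ys))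

Modest : (p q d k : ℕ) → Vec ℕ (suc d) → Set
Modest p q d k M =
  InU p q d k M × (∀ (m : Vec ℕ (suc d)) → InU p q d k m → ¬ (reverse M <lex reverse m))

tdeg : (d : ℕ) → Vec ℕ (suc d) → ℕ
tdeg d m = sum (tabulate (λ (i : Fin (suc d)) → (d ∸ toℕ i) * lookup m i))

{-# OPTIONS --safe #-}

-- Read each m_i as a heap of coins: a coin of value p ^ n for every unit of its n-th base-p digit.  Modulo q ∸ 1 the
-- value of a coin depends only on its type n mod f, and p coins of one type may be carried to one coin of the next type,
-- cyclically.  A heap is a positive multiple of q ∸ 1 exactly when finitely many carries turn it into p ∸ 1 coins of each
-- type.  Deal out the coins from the largest down.  What a level still needs is then a vector of digits, dealing it a coin
-- is a subtraction with cyclic borrow, and the borrow must be covered by the total number of carries at each digit, which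
-- does not depend on the way the remaining coins are dealt.
--
-- Suppose level i gets a coin although level i + 1 could have had it.  Giving it to level i + 1 instead can be repaired by
-- moving smaller coins, each of them down by at most one level: the missing carries are passed along the levels
-- 0, 1, …, i + 1.  As the coins smaller than p ^ n are together worth less than p ^ n, the degree drops; and the result is
-- larger in the reverse lexicographic order, because level i + 1 gains its largest new coin.  Two elements of U_d(k) that
-- both admit no such improvement are equal.  The modest element admits none, so every other element can be improved until
-- the modest one is reached, and the degree drops all the way.
module Submission where

open import Defs
open import Data.Nat hiding (compare)
open import Data.Nat.Properties
open import Data.Nat.DivMod
open import Data.Nat.Divisibility
open import Data.Nat.Primality using (Prime; ¬prime[0]; ¬prime[1])
open import Data.Nat.Induction using (<-wellFounded)
open import Data.Nat.Tactic.RingSolver using (solve-∀)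
open import Data.Fin as F using (Fin; toℕ; fromℕ; inject₁) renaming (zero to fzero; suc to fsuc)
import Data.Fin.Properties as FP
open import Data.Vec using (Vec; []; _∷_; lookup; tabulate; sum; reverse; _∷ʳ_)
import Data.Vec as Vec
import Data.Vec.Properties as VecP
open import Data.Product using (_×_; _,_; proj₁; proj₂; ∃-syntax)
open import Data.Sum using (_⊎_; inj₁; inj₂)
open import Induction.WellFounded using (Acc; acc)
open import Relation.Binary.Definitions using (tri<; tri≈; tri>)
open import Relation.Binary.PropositionalEquality
open import Relation.Nullary using (¬_; Dec; yes; no; contradiction)

-- Linear arithmetic by cancellation: a hypothesis is added to the goal, and the two sides are then equal by ring laws.
lin-≤ : ∀ {a b} x y → a ≤ b → x + b ≡ y + a → x ≤ y
lin-≤ {a} {b} x y a≤b e = +-cancelʳ-≤ b x y (≤-trans (≤-reflexive e) (+-monoʳ-≤ y a≤b))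

lin-≡ : ∀ {a b} x y → a ≡ b → x + b ≡ y + a → x ≡ y
lin-≡ {a} x y refl e = +-cancelʳ-≡ a x y e

-- Finite sums over initial segments.

sumTo : ℕ → (ℕ → ℕ) → ℕ
sumTo zero    F = 0
sumTo (suc n) F = sumTo n F + F n

sumTo-cong : ∀ n {F G : ℕ → ℕ} → (∀ l → l < n → F l ≡ G l) → sumTo n F ≡ sumTo n G
sumTo-cong zero    h = refl
sumTo-cong (suc n) h = cong₂ _+_ (sumTo-cong n (λ l l<n → h l (m<n⇒m<1+n l<n))) (h n ≤-refl)

sumTo-+ : ∀ n (F G : ℕ → ℕ) → sumTo n (λ l → F l + G l) ≡ sumTo n F + sumTo n G
sumTo-+ zero    F G = refl
sumTo-+ (suc n) F G = trans (cong (_+ (F n + G n)) (sumTo-+ n F G)) (interchange (sumTo n F) (sumTo n G) (F n) (G n))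
  where
  interchange : ∀ a b c d → a + b + (c + d) ≡ a + c + (b + d)
  interchange = solve-∀

sumTo-* : ∀ n c (F : ℕ → ℕ) → sumTo n (λ l → c * F l) ≡ c * sumTo n F
sumTo-* zero    c F = sym (*-zeroʳ c)
sumTo-* (suc n) c F = trans (cong (_+ c * F n) (sumTo-* n c F)) (sym (*-distribˡ-+ c (sumTo n F) (F n)))

sumTo-*ʳ : ∀ n c (F : ℕ → ℕ) → sumTo n (λ l → F l * c) ≡ sumTo n F * c
sumTo-*ʳ zero    c F = refl
sumTo-*ʳ (suc n) c F = trans (cong (_+ F n * c) (sumTo-*ʳ n c F)) (sym (*-distribʳ-+ c (sumTo n F) (F n)))

sumTo-0 : ∀ n {F : ℕ → ℕ} → (∀ l → l < n → F l ≡ 0) → sumTo n F ≡ 0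
sumTo-0 zero    h = refl
sumTo-0 (suc n) h = cong₂ _+_ (sumTo-0 n (λ l l<n → h l (m<n⇒m<1+n l<n))) (h n ≤-refl)

sumTo-mono : ∀ n {F G : ℕ → ℕ} → (∀ l → l < n → F l ≤ G l) → sumTo n F ≤ sumTo n G
sumTo-mono zero    h = z≤n
sumTo-mono (suc n) h = +-mono-≤ (sumTo-mono n (λ l l<n → h l (m<n⇒m<1+n l<n))) (h n ≤-refl)

sumTo-prefix : ∀ {m n} (F : ℕ → ℕ) → m ≤ n → sumTo m F ≤ sumTo n F
sumTo-prefix {m} {zero}  F z≤n = ≤-refl
sumTo-prefix {m} {suc n} F m≤ with m ≟ suc n
... | yes refl = ≤-refl
... | no m≢    = ≤-trans (sumTo-prefix {m} {n} F (s≤s⁻¹ (≤∧≢⇒< m≤ m≢))) (m≤m+n _ _)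

term≤sumTo : ∀ n (F : ℕ → ℕ) {l} → l < n → F l ≤ sumTo n F
term≤sumTo (suc n) F {l} (s≤s l≤n) with l ≟ n
... | yes refl = m≤n+m (F n) (sumTo n F)
... | no l≢n   = ≤-trans (term≤sumTo n F (≤∧≢⇒< l≤n l≢n)) (m≤m+n (sumTo n F) (F n))

sumTo-comm : ∀ m n (F : ℕ → ℕ → ℕ) → sumTo m (λ i → sumTo n (F i)) ≡ sumTo n (λ j → sumTo m (λ i → F i j))
sumTo-comm m zero    F = sumTo-0 m (λ _ _ → refl)
sumTo-comm m (suc n) F = trans (sumTo-+ m (λ i → sumTo n (F i)) (λ i → F i n)) (cong (_+ sumTo m (λ i → F i n)) (sumTo-comm m n F))

sumTo-pos : ∀ n (F : ℕ → ℕ) → 0 < sumTo n F → ∃[ l ] (l < n × 0 < F l)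
sumTo-pos (suc n) F pos with F n in eq
... | suc x = n , ≤-refl , subst (0 <_) (sym eq) z<s
... | zero with sumTo-pos n F (subst (0 <_) (+-identityʳ _) pos)
...   | l , l<n , Fl = l , m<n⇒m<1+n l<n , Fl

sumTo-zero⇒term : ∀ n (F : ℕ → ℕ) → sumTo n F ≡ 0 → ∀ l → l < n → F l ≡ 0
sumTo-zero⇒term n F e l l<n = n≤0⇒n≡0 (subst (F l ≤_) e (term≤sumTo n F l<n))

sumTo-tail-zero : ∀ n k (F : ℕ → ℕ) → k ≤ n → (∀ l → k ≤ l → l < n → F l ≡ 0) → sumTo n F ≡ sumTo k F
sumTo-tail-zero zero    k F z≤n h = refl
sumTo-tail-zero (suc n) k F k≤1+n h with k ≟ suc n
... | yes refl = refl
... | no k≢    = trans (cong₂ _+_ (sumTo-tail-zero n k F k≤n (λ l k≤l l<n → h l k≤l (m<n⇒m<1+n l<n))) (h n k≤n ≤-refl)) (+-identityʳ _)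
  where k≤n = s≤s⁻¹ (≤∧≢⇒< k≤1+n k≢)

two-terms≤sumTo : ∀ n (F : ℕ → ℕ) {i j} → i < j → j < n → F i + F j ≤ sumTo n F
two-terms≤sumTo (suc n) F {i} {j} i<j (s≤s j≤n) with j ≟ n
... | yes refl = +-monoˡ-≤ (F n) (term≤sumTo n F i<j)
... | no j≢n   = ≤-trans (two-terms≤sumTo n F i<j (≤∧≢⇒< j≤n j≢n)) (m≤m+n _ _)

-- Made for moving coins between the levels `g` and `suc g`. The offsets `a` and `b` express the
-- change of the two affected terms without subtraction, so that conserved columns (both offsets 0)
-- and the cost are covered alike.
pair-change : ∀ n g (F G : ℕ → ℕ) a b → suc g < n → (∀ l → l ≢ g → l ≢ suc g → F l ≡ G l) →
  F g + F (suc g) + a ≡ G g + G (suc g) + b → sumTo n F + a ≡ sumTo n G + b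
pair-change (suc n) g F G a b (s≤s g<n) same e with suc g ≟ n
... | yes refl = lin-≡ _ _ (cong₂ _+_ e low) (regroup (sumTo g F) (F g) (F (suc g)) a (sumTo g G) (G g) (G (suc g)) b)
  where
  low : sumTo g F ≡ sumTo g G
  low = sumTo-cong g (λ l l<g → same l (<⇒≢ l<g) (<⇒≢ (m<n⇒m<1+n l<g)))
  regroup : ∀ sF x y a sG z w b → sF + x + y + a + (z + w + b + sG) ≡ sG + z + w + b + (x + y + a + sF)
  regroup = solve-∀
... | no 1+g≢n = lin-≡ _ _ (cong₂ _+_ (pair-change n g F G a b 1+g<n same e) (same n (>⇒≢ (<-trans ≤-refl 1+g<n)) (>⇒≢ 1+g<n)))
    (regroup (sumTo n F) (F n) a (sumTo n G) (G n) b)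
  where
  1+g<n = ≤∧≢⇒< g<n 1+g≢n
  regroup : ∀ sF x a sG y b → sF + x + a + (sG + b + y) ≡ sG + y + b + (sF + a + x)
  regroup = solve-∀

-- Replacing two adjacent entries, Kronecker deltas and finite vectors.

module _ {X : Set} where
  replace : (ℕ → X) → ℕ → X → X → ℕ → X
  replace A zero    P U zero          = P
  replace A zero    P U (suc zero)    = U
  replace A zero    P U (suc (suc l)) = A (suc (suc l))
  replace A (suc g) P U zero          = A zero
  replace A (suc g) P U (suc l)       = replace (λ l → A (suc l)) g P U l

  replace-first : ∀ A g P U → replace A g P U g ≡ P
  replace-first A zero    P U = refl
  replace-first A (suc g) P U = replace-first (λ l → A (suc l)) g P U

  replace-second : ∀ A g P U → replace A g P U (suc g) ≡ U
  replace-second A zero    P U = refl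
  replace-second A (suc g) P U = replace-second (λ l → A (suc l)) g P U

  replace-other : ∀ A g P U l → l ≢ g → l ≢ suc g → replace A g P U l ≡ A l
  replace-other A zero    P U zero          ≢g ≢1+g = contradiction refl ≢g
  replace-other A zero    P U (suc zero)    ≢g ≢1+g = contradiction refl ≢1+g
  replace-other A zero    P U (suc (suc l)) ≢g ≢1+g = refl
  replace-other A (suc g) P U zero          ≢g ≢1+g = refl
  replace-other A (suc g) P U (suc l)       ≢g ≢1+g =
    replace-other (λ l → A (suc l)) g P U l (λ e → ≢g (cong suc e)) (λ e → ≢1+g (cong suc e))

δ : ∀ {n} → Fin n → Fin n → ℕ
δ i j with i F.≟ j
... | yes _ = 1
... | no  _ = 0

δ-refl : ∀ {n} (i : Fin n) → δ i i ≡ 1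
δ-refl i with i F.≟ i
... | yes _  = refl
... | no i≢i = contradiction refl i≢i

δ-≢ : ∀ {n} {i j : Fin n} → i ≢ j → δ i j ≡ 0
δ-≢ {i = i} {j} i≢j with i F.≟ j
... | yes e = contradiction e i≢j
... | no _  = refl

δ≤1 : ∀ {n} (i j : Fin n) → δ i j ≤ 1
δ≤1 i j with i F.≟ j
... | yes _ = ≤-refl
... | no _  = z≤n

total : ∀ {n} → (Fin n → ℕ) → ℕ
total {zero}  v = 0
total {suc n} v = v fzero + total (λ i → v (fsuc i))

term≤total : ∀ {n} (v : Fin n → ℕ) i → v i ≤ total v
term≤total v fzero    = m≤m+n _ _
term≤total v (fsuc i) = ≤-trans (term≤total (λ i → v (fsuc i)) i) (m≤n+m _ _)

total-mono : ∀ {n} {v w : Fin n → ℕ} → (∀ i → v i ≤ w i) → total v ≤ total w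
total-mono {zero}  h = z≤n
total-mono {suc n} h = +-mono-≤ (h fzero) (total-mono (λ i → h (fsuc i)))

total-strict : ∀ {n} {v w : Fin n → ℕ} i → (∀ i → v i ≤ w i) → v i < w i → total v < total w
total-strict fzero    h lt = +-mono-<-≤ lt (total-mono (λ i → h (fsuc i)))
total-strict (fsuc i) h lt = +-mono-≤-< (h fzero) (total-strict i (λ i → h (fsuc i)) lt)

-- Cyclic carries and borrows between the coin types.

module Cyclic (p : ℕ) (1<p : 1 < p) (f′ : ℕ) where

  T : Set
  T = Fin (suc f′)

  prev : T → T
  prev fzero    = fromℕ f′
  prev (fsuc i) = inject₁ i

  prev-injective : ∀ {s t} → prev s ≡ prev t → s ≡ t
  prev-injective {fzero}  {fzero}  e = refl
  prev-injective {fzero}  {fsuc t} e = contradiction e FP.fromℕ≢inject₁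
  prev-injective {fsuc s} {fzero}  e = contradiction (sym e) FP.fromℕ≢inject₁
  prev-injective {fsuc s} {fsuc t} e = cong fsuc (FP.inject₁-injective e)

  -- E is the vector of the numbers of coins of value p ^ t (exponent mod f).
  -- Replacing p coins of type t by one of type t + 1, σ t times for each t, turns E into u.
  Carries : (E σ u : T → ℕ) → Set
  Carries E σ u = ∀ t → E t + σ (prev t) ≡ u t + p * σ t

  carries-cong : ∀ {E E′ σ σ′ u u′} → (∀ t → E t ≡ E′ t) → (∀ t → σ t ≡ σ′ t) → (∀ t → u t ≡ u′ t) →
    Carries E σ u → Carries E′ σ′ u′
  carries-cong hE hσ hu c t = trans (sym (cong₂ _+_ (hE t) (hσ (prev t)))) (trans (c t) (cong₂ _+_ (hu t) (cong (p *_) (hσ t))))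

  -- The smallest solution below ζ of the upper bound also satisfies the lower bound, that is, it uses a nonnegative number of coins.
  settle : ∀ (u c ζ : T → ℕ) → (∀ t → u t + p * ζ t ≤ c t + ζ (prev t)) →
    ∃[ ζ′ ] (∀ t → ζ′ t ≤ ζ t) × (∀ t → u t + p * ζ′ t ≤ c t + ζ′ (prev t)) × (∀ t → ζ′ (prev t) ≤ u t + p * ζ′ t)
  settle u c ζ up = go ζ up (<-wellFounded (total ζ))
    where
    go : ∀ ζ → (∀ t → u t + p * ζ t ≤ c t + ζ (prev t)) → Acc _<_ (total ζ) →
      ∃[ ζ′ ] (∀ t → ζ′ t ≤ ζ t) × (∀ t → u t + p * ζ′ t ≤ c t + ζ′ (prev t)) × (∀ t → ζ′ (prev t) ≤ u t + p * ζ′ t)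
    go ζ up (acc rec) with FP.all? (λ t → ζ (prev t) ≤? u t + p * ζ t)
    ... | yes low = ζ , (λ _ → ≤-refl) , up , low
    ... | no ¬low with FP.¬∀⟶∃¬ _ _ (λ t → ζ (prev t) ≤? u t + p * ζ t) ¬low
    ...   | s , ζ≰ = let (ζ′ , le , up′ , low′) = go ζ₁ up₁ (rec (total-strict (prev s) ζ₁≤ζ ζ₁<ζ))
                     in ζ′ , (λ t → ≤-trans (le t) (ζ₁≤ζ t)) , up′ , low′
      where
      ζ< : u s + p * ζ s < ζ (prev s)
      ζ< = ≰⇒> ζ≰
      ζ₁ : T → ℕ
      ζ₁ t = ζ t ∸ δ (prev s) t
      ζ₁≤ζ : ∀ t → ζ₁ t ≤ ζ t
      ζ₁≤ζ t = m∸n≤m (ζ t) (δ (prev s) t)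
      ζ₁<ζ : ζ₁ (prev s) < ζ (prev s)
      ζ₁<ζ rewrite δ-refl (prev s) = ∸-monoʳ-< {ζ (prev s)} {1} {0} z<s (≤-trans z<s ζ<)
      up₁ : ∀ t → u t + p * ζ₁ t ≤ c t + ζ₁ (prev t)
      up₁ t with s F.≟ t
      -- The failed lower bound gives `u s + p * ζ s ≤ ζ (prev s) ∸ 1`, so at `s` the upper bound
      -- survives the decrease. Elsewhere its right side is unchanged, as `prev` is injective.
      ... | yes refl rewrite δ-refl (prev s) = ≤-trans (+-monoʳ-≤ (u s) (*-monoʳ-≤ p (ζ₁≤ζ s)))
              (≤-trans (∸-monoˡ-≤ {suc (u s + p * ζ s)} 1 ζ<) (m≤n+m _ (c s)))
      ... | no s≢t rewrite δ-≢ {i = prev s} {prev t} (λ e → s≢t (prev-injective e)) =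
              ≤-trans (+-monoʳ-≤ (u t) (*-monoʳ-≤ p (ζ₁≤ζ t))) (up t)

  private
    -- By the equations, each step of `prev` multiplies the excess of `α` over `β` by `p`, so a
    -- positive excess grows by at least one.
    excess-grows : ∀ (α β : T → ℕ) → (∀ t → p * α t + β (prev t) ≡ p * β t + α (prev t)) →
      ∀ n t x → β t + suc x ≤ α t → ∃[ s ] suc x + n ≤ α s
    excess-grows α β e zero    t x h = t , ≤-trans (≤-reflexive (+-identityʳ (suc x))) (m+n≤o⇒n≤o (β t) h)
    excess-grows α β e (suc n) t x h = let (s , le) = excess-grows α β e n (prev t) (suc x) step
                                       in s , ≤-trans (≤-reflexive (+-suc (suc x) n)) le
      where
      rearrange : ∀ p α β x β′ α′ → β′ + p * x + (p * α + (p * β + α′)) ≡ α′ + (p * (β + x) + (p * α + β′))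
      rearrange = solve-∀
      step : β (prev t) + suc (suc x) ≤ α (prev t)
      step = ≤-trans (+-monoʳ-≤ (β (prev t)) 2+x≤)
        (lin-≤ _ _ (+-mono-≤ (*-monoʳ-≤ p h) (≤-reflexive (e t)))
          (rearrange p (α t) (β t) (suc x) (β (prev t)) (α (prev t))))
        where
        2+x≤ : suc (suc x) ≤ p * suc x
        2+x≤ = ≤-trans (s≤s (s≤s (≤-trans (m≤n+m x x) (≤-reflexive (cong (x +_) (sym (+-identityʳ x)))))))
               (≤-trans (≤-reflexive (cong suc (sym (+-suc x (x + 0))))) (*-monoˡ-≤ (suc x) 1<p))

    carries-≤ : ∀ (α β : T → ℕ) → (∀ t → p * α t + β (prev t) ≡ p * β t + α (prev t)) → ∀ t → α t ≤ β t
    carries-≤ α β e t with α t ≤? β t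
    ... | yes α≤β = α≤β
    -- After `total α` steps some entry of `α` would exceed `total α`.
    ... | no α≰β =
      let (s , le) = excess-grows α β e (total α) t 0 (≤-trans (≤-reflexive (+-comm (β t) 1)) (≰⇒> α≰β))
      in contradiction (term≤total α s) (<⇒≱ le)

  -- The difference of two solutions solves a homogeneous cyclic system that multiplies it by `p`
  -- along `prev`; on a finite cycle it must vanish.
  carries-unique : ∀ {E u σ τ} → Carries E σ u → Carries E τ u → ∀ t → σ t ≡ τ t
  carries-unique {E} {u} {σ} {τ} cσ cτ t = ≤-antisym (carries-≤ σ τ e t) (carries-≤ τ σ (λ s → sym (e s)) t)
    where
    regroup : ∀ E u pσ pτ σ τ → pσ + τ + (u + pτ + (E + σ)) ≡ pτ + σ + (E + τ + (u + pσ))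
    regroup = solve-∀
    e : ∀ s → p * σ s + τ (prev s) ≡ p * τ s + σ (prev s)
    e s = lin-≡ _ _ (cong₂ _+_ (cτ s) (sym (cσ s))) (regroup (E s) (u s) (p * σ s) (p * τ s) (σ (prev s)) (τ (prev s)))

  -- The digits that a borrow starting at j passes through: the maximal run of zero digits of u from j upwards.
  data Run (u : T → ℕ) (j : T) : T → Set where
    start : u j ≡ 0 → Run u j j
    step  : ∀ {s} → Run u j (prev s) → u s ≡ 0 → Run u j s

  run-zero : ∀ {u j t} → Run u j t → u t ≡ 0
  run-zero (start e)  = e
  run-zero (step _ e) = e

  run-nonempty : ∀ {u j t} → Run u j t → Run u j j
  run-nonempty (start e)  = start e
  run-nonempty (step r _) = run-nonempty r

  run-mono : ∀ {u v j} → (∀ t → u t ≡ 0 → v t ≡ 0) → ∀ {t} → Run u j t → Run v j t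
  run-mono h (start e)  = start (h _ e)
  run-mono h (step r e) = step (run-mono h r) (h _ e)

  run-inv : ∀ {u j t} → Run u j t → j ≡ t ⊎ Run u j (prev t)
  run-inv (start _)  = inj₁ refl
  run-inv (step r _) = inj₂ r

  private
    -- The cyclic distance from `j` up to `t`, which is the termination measure of `run?`.
    steps-from : T → T → ℕ
    steps-from j t with toℕ j ≤? toℕ t
    ... | yes _ = toℕ t ∸ toℕ j
    ... | no  _ = toℕ t + suc f′ ∸ toℕ j

    steps-from-prev : ∀ j t → j ≢ t → steps-from j (prev t) < steps-from j t
    steps-from-prev j fzero j≢t with toℕ j ≤? toℕ (fromℕ f′) | toℕ j ≤? 0
    ... | _ | yes j≤0 = contradiction (FP.toℕ-injective (n≤0⇒n≡0 j≤0)) j≢t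
    ... | yes j≤f′ | no _ = ∸-monoˡ-< (s≤s (≤-reflexive (FP.toℕ-fromℕ f′))) j≤f′
    ... | no j≰f′ | no _ = contradiction (≤-trans (FP.toℕ≤pred[n] j) (≤-reflexive (sym (FP.toℕ-fromℕ f′)))) j≰f′
    steps-from-prev j (fsuc t) j≢t with toℕ j ≤? toℕ (inject₁ t) | toℕ j ≤? suc (toℕ t)
    ... | yes j≤t | yes _ = ∸-monoˡ-< (s≤s (≤-reflexive (FP.toℕ-inject₁ t))) j≤t
    ... | yes j≤t | no j≰ = contradiction (≤-trans j≤t (≤-trans (≤-reflexive (FP.toℕ-inject₁ t)) (n≤1+n _))) j≰
    ... | no j≰t | yes j≤ = contradiction (FP.toℕ-injective (≤-antisym j≤ (≤-trans (s≤s (≤-reflexive (sym (FP.toℕ-inject₁ t)))) (≰⇒> j≰t)))) j≢t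
    ... | no _ | no j≰ = ∸-monoˡ-< (s≤s (≤-reflexive (cong (_+ suc f′) (FP.toℕ-inject₁ t))))
            (≤-trans (FP.toℕ≤n j) (m≤n+m _ _))

  run? : ∀ u j t → Dec (Run u j t)
  run? u j t = go t (<-wellFounded (steps-from j t))
    where
    go : ∀ t → Acc _<_ (steps-from j t) → Dec (Run u j t)
    go t (acc rec) with u t ≟ 0
    ... | no ut≢0 = no (λ r → ut≢0 (run-zero r))
    ... | yes ut≡0 with j F.≟ t
    ...   | yes refl = yes (start ut≡0)
    ...   | no j≢t with go (prev t) (rec (steps-from-prev j t j≢t))
    ...     | yes r = yes (step r ut≡0)
    ...     | no ¬r = no λ { (start _) → j≢t refl ; (step r _) → ¬r r }

  -- The borrow vector for subtracting one unit at `j`: each digit of the run is 0 and has to borrow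
  -- `p` from the next digit.
  run : (T → ℕ) → T → T → ℕ
  run u j t with run? u j t
  ... | yes _ = 1
  ... | no  _ = 0

  run≤1 : ∀ u j t → run u j t ≤ 1
  run≤1 u j t with run? u j t
  ... | yes _ = ≤-refl
  ... | no  _ = z≤n

  run≡1 : ∀ {u j t} → Run u j t → run u j t ≡ 1
  run≡1 {u} {j} {t} r with run? u j t
  ... | yes _ = refl
  ... | no ¬r = contradiction r ¬r

  run≡0 : ∀ {u j t} → ¬ Run u j t → run u j t ≡ 0
  run≡0 {u} {j} {t} ¬r with run? u j t
  ... | yes r = contradiction r ¬r
  ... | no _  = refl

  run≤ : ∀ {u j t x} → (Run u j t → 1 ≤ x) → run u j t ≤ x
  run≤ {u} {j} {t} h with run? u j t
  ... | yes r = h r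
  ... | no _  = z≤n

  run-pos : ∀ {u j t} → 0 < run u j t → Run u j t
  run-pos {u} {j} {t} pos with run? u j t
  ... | yes r = r
  ... | no _ with () ← pos

  -- A digit of the run receives `p ≥ 2` units, enough for the coin and a borrow together. Outside
  -- the run, a digit other than `j` that is borrowed from is nonzero, since otherwise it would
  -- continue the run; and if `j` is outside, the run is empty and `u j` is positive.
  run-borrow : ∀ u j t → δ j t + run u j (prev t) ≤ u t + p * run u j t
  run-borrow u j t with run? u j t
  ... | yes r = ≤-trans (+-mono-≤ (δ≤1 j t) (run≤1 u j (prev t)))
          (≤-trans 1<p (≤-trans (≤-reflexive (sym (*-identityʳ p))) (m≤n+m _ (u t))))
  ... | no ¬r with j F.≟ t
  ...   | yes refl with u j in uj
  ...     | zero = contradiction (start uj) ¬r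
  ...     | suc x = ≤-trans (≤-reflexive (cong suc (run≡0 (λ r → ¬r (run-nonempty r))))) (s≤s z≤n)
  run-borrow u j t | no ¬r | no j≢t = ≤-trans (run≤ prevrun) (m≤m+n (u t) _)
    where
    prevrun : Run u j (prev t) → 1 ≤ u t
    prevrun r with u t in ut
    ... | zero  = contradiction (step r ut) ¬r
    ... | suc _ = s≤s z≤n

  -- A zero digit that receives a coin or a carry must carry in turn, so the coin at `j` sets off
  -- carries along the whole run.
  run-carries : ∀ {E σ u j} → Carries E σ u → 1 ≤ E j → ∀ {t} → Run u j t → 1 ≤ σ t
  run-carries {E} {σ} {u} {j} c pos = go
    where
    positive : ∀ t → u t ≡ 0 → 1 ≤ E t + σ (prev t) → 1 ≤ σ t
    positive t ut h with σ t | subst (λ x → E t + σ (prev t) ≡ x + p * σ t) ut (c t)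
    ... | suc _ | _ = s≤s z≤n
    ... | zero  | e = contradiction (trans e (*-zeroʳ p)) (>⇒≢ h)
    go : ∀ {t} → Run u j t → 1 ≤ σ t
    go (start e)  = positive j e (≤-trans pos (m≤m+n _ _))
    go (step {s} r e) = positive s e (≤-trans (go r) (m≤n+m _ (E s)))

  -- Positions from which going up reaches b through zero digits of u.
  data Below (u : T → ℕ) (b : T) : T → Set where
    end  : u b ≡ 0 → Below u b b
    back : ∀ {s} → Below u b s → u (prev s) ≡ 0 → Below u b (prev s)

  run⇒below : ∀ {u j b} → Run u j b → Below u b j
  run⇒below r = go r (end (run-zero r))
    where
    go : ∀ {u j b t} → Run u j t → Below u b t → Below u b j
    go (start _)  q = q
    go (step r _) q = go r (back q (run-zero r))

  below-step : ∀ {u b t} → Below u b (prev t) → prev t ≢ b → Below u b t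
  below-step {u} {b} {t} q ≢b = go q refl
    where
    go : ∀ {s} → Below u b s → s ≡ prev t → Below u b t
    go (end _)    e = contradiction (sym e) ≢b
    go (back q _) e = subst (Below u b) (prev-injective e) q

  -- Induction downwards from `b`: a digit with `v` and `σ` both 0 cannot have received a carry, so
  -- the digit before it sends none.
  below-blocked : ∀ {E σ u v b} → Carries E σ v → (∀ t → u t ≡ 0 → v t ≡ 0) → σ b ≡ 0 →
    ∀ {t} → Below u b t → v t ≡ 0 × σ t ≡ 0
  below-blocked c h σb (end e) = h _ e , σb
  below-blocked {E} {σ} c h σb (back {s} q e) with below-blocked c h σb q
  ... | vs , σs = h _ e , m+n≡0⇒n≡0 (E s) (trans (c s) (cong₂ _+_ vs (trans (cong (p *_) σs) (*-zeroʳ p))))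

-- Coins at positions, and redistribution between two adjacent levels.

δℕ : ℕ → ℕ → ℕ
δℕ m n with m ≟ n
... | yes _ = 1
... | no  _ = 0

δℕ-refl : ∀ n → δℕ n n ≡ 1
δℕ-refl n with n ≟ n
... | yes _  = refl
... | no n≢n = contradiction refl n≢n

δℕ-≢ : ∀ {m n} → m ≢ n → δℕ m n ≡ 0
δℕ-≢ {m} {n} m≢n with m ≟ n
... | yes e = contradiction e m≢n
... | no _  = refl

sumTo-gap : ∀ n (F : ℕ → ℕ) {m l} → m ≤ l → l < n → sumTo m F + F l ≤ sumTo n F
sumTo-gap (suc n) F {m} {l} m≤l (s≤s l≤n) with l ≟ n
... | yes refl = +-monoˡ-≤ (F l) (sumTo-prefix F m≤l)
... | no l≢n = ≤-trans (sumTo-gap n F m≤l (≤∧≢⇒< l≤n l≢n)) (m≤m+n _ _)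

sumTo-grows : ∀ n (F : ℕ → ℕ) m → sumTo m F < sumTo n F → ∃[ l ] (m ≤ l × l < n × 0 < F l)
sumTo-grows (suc n) F m lt with F n in eq
... | zero with sumTo-grows n F m (subst (sumTo m F <_) (+-identityʳ _) lt)
...   | l , m≤l , l<n , pos = l , m≤l , m<n⇒m<1+n l<n , pos
sumTo-grows (suc n) F m lt | suc x with m ≤? n
... | yes m≤n = n , m≤n , ≤-refl , subst (0 <_) (sym eq) z<s
... | no m≰n  = contradiction (subst (λ y → sumTo n F + y ≤ sumTo m F) eq (sumTo-prefix F (≰⇒> m≰n))) (<⇒≱ lt)

module Coins (p : ℕ) (1<p : 1 < p) (f′ : ℕ) (ty : ℕ → Fin (suc f′)) where
  open Cyclic p 1<p f′ public

  cnt : ℕ → (ℕ → ℕ) → T → ℕ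
  cnt N a t = sumTo N (λ n → δ (ty n) t * a n)

  val : ℕ → (ℕ → ℕ) → ℕ
  val N a = sumTo N (λ n → a n * p ^ n)

  cnt-+ : ∀ N a b t → cnt N (λ n → a n + b n) t ≡ cnt N a t + cnt N b t
  cnt-+ N a b t = trans (sumTo-cong N (λ n _ → *-distribˡ-+ (δ (ty n) t) (a n) (b n)))
    (sumTo-+ N (λ n → δ (ty n) t * a n) (λ n → δ (ty n) t * b n))

  cnt-cong : ∀ N {a b} → (∀ n → n < N → a n ≡ b n) → ∀ t → cnt N a t ≡ cnt N b t
  cnt-cong N h t = sumTo-cong N (λ n n<N → cong (δ (ty n) t *_) (h n n<N))

  val-+ : ∀ N a b → val N (λ n → a n + b n) ≡ val N a + val N b
  val-+ N a b = trans (sumTo-cong N (λ n _ → *-distribʳ-+ (p ^ n) (a n) (b n)))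
    (sumTo-+ N (λ n → a n * p ^ n) (λ n → b n * p ^ n))

  val-cong : ∀ N {a b} → (∀ n → n < N → a n ≡ b n) → val N a ≡ val N b
  val-cong N h = sumTo-cong N (λ n n<N → cong (_* p ^ n) (h n n<N))

  val-mono : ∀ N {a b} → (∀ n → a n ≤ b n) → val N a ≤ val N b
  val-mono N h = sumTo-mono N (λ n _ → *-monoˡ-≤ (p ^ n) (h n))

  val< : ∀ N a → (∀ n → n < N → a n < p) → val N a < p ^ N
  val< zero    a h = z<s
  val< (suc N) a h = ≤-trans (+-monoˡ-< (a N * p ^ N) (val< N a (λ n n<N → h n (m<n⇒m<1+n n<N)))) (*-monoˡ-≤ (p ^ N) (h N ≤-refl))

  -- Greedy choice from the highest position down. Either the demand for that type is met there or
  -- the position is used up; in both cases the lower positions can serve what is left.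
  select : ∀ N (Q : ℕ → ℕ) (E : T → ℕ) → (∀ t → E t ≤ cnt N Q t) →
    ∃[ a ] ((∀ n → a n ≤ Q n) × (∀ n → N ≤ n → a n ≡ 0) × (∀ t → cnt N a t ≡ E t))
  select zero    Q E h = (λ _ → 0) , (λ _ → z≤n) , (λ _ _ → refl) , (λ t → sym (n≤0⇒n≡0 (h t)))
  select (suc B) Q E h with select B Q E′ E′≤
    where
    x = Q B ⊓ E (ty B)
    E′ : T → ℕ
    E′ t = E t ∸ δ (ty B) t * x
    E′≤ : ∀ t → E′ t ≤ cnt B Q t
    E′≤ t with ty B F.≟ t | h t
    ... | no _     | le = subst (E t ≤_) (+-identityʳ _) le
    ... | yes refl | le with ≤-total (Q B) (E (ty B))
    ...   | inj₁ Q≤E rewrite m≤n⇒m⊓n≡m Q≤E | +-identityʳ (Q B) = m≤n+o⇒m∸n≤o (E (ty B)) (Q B) (subst (E (ty B) ≤_) (+-comm (cnt B Q (ty B)) (Q B)) le)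
    ...   | inj₂ E≤Q rewrite m≥n⇒m⊓n≡n E≤Q | +-identityʳ (E (ty B)) | n∸n≡0 (E (ty B)) = z≤n
  ... | a , a≤Q , a-zero , a-cnt = a′ , a′≤Q , a′-zero , a′-cnt
    where
    x = Q B ⊓ E (ty B)
    a′ : ℕ → ℕ
    a′ n with n ≟ B
    ... | yes _ = x
    ... | no  _ = a n
    a′≤Q : ∀ n → a′ n ≤ Q n
    a′≤Q n with n ≟ B
    ... | yes refl = m⊓n≤m (Q B) _
    ... | no _     = a≤Q n
    a′-zero : ∀ n → suc B ≤ n → a′ n ≡ 0
    a′-zero n B<n with n ≟ B
    ... | yes refl = contradiction B<n (<-irrefl refl)
    ... | no _     = a-zero n (<⇒≤ B<n)
    a′-below : ∀ n → n < B → a′ n ≡ a n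
    a′-below n n<B with n ≟ B
    ... | yes refl = contradiction n<B (<-irrefl refl)
    ... | no _     = refl
    a′-top : a′ B ≡ x
    a′-top with B ≟ B
    ... | yes _  = refl
    ... | no B≢B = contradiction refl B≢B
    x≤ : ∀ t → δ (ty B) t * x ≤ E t
    x≤ t with ty B F.≟ t
    ... | yes refl = ≤-trans (≤-reflexive (+-identityʳ x)) (m⊓n≤n (Q B) _)
    ... | no _     = z≤n
    a′-cnt : ∀ t → cnt (suc B) a′ t ≡ E t
    a′-cnt t = trans (cong₂ _+_ (trans (cnt-cong B a′-below t) (a-cnt t)) (cong (δ (ty B) t *_) a′-top)) (m∸n+n≡m (x≤ t))

  record Redistributed N (P U Q : ℕ → ℕ) (σP σU uP uU ζ₀ : T → ℕ) : Set where
    field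
      P′ U′      : ℕ → ℕ
      σP′ σU′    : T → ℕ
      P′≤Q       : ∀ n → P′ n ≤ Q n
      conserve   : ∀ n → P′ n + U′ n ≡ P n + U n
      P′-carries : Carries (cnt N P′) σP′ uP
      U′-carries : Carries (cnt N U′) σU′ uU
      σP′≤ζ₀     : ∀ t → σP′ t ≤ ζ₀ t
      σ-conserve : ∀ t → σP′ t + σU′ t ≡ σP t + σU t

  -- `Q` is the pool from which the first level may draw and `ζ₀` its allowance of carries. `settle`
  -- shrinks the allowance until it calls for a nonnegative number of coins, `select` picks them,
  -- and everything else goes to the second level, whose equations follow because coins and carries
  -- are conserved.
  redistribute : ∀ N P U Q {σP σU uP uU ζ₀} → Carries (cnt N P) σP uP → Carries (cnt N U) σU uU →
    (∀ n → Q n ≤ P n + U n) → (∀ t → ζ₀ t ≤ σP t + σU t) → (∀ t → uP t + p * ζ₀ t ≤ cnt N Q t + ζ₀ (prev t)) →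
    Redistributed N P U Q σP σU uP uU ζ₀
  redistribute N P U Q {σP} {σU} {uP} {uU} {ζ₀} cP cU Q≤ ζ₀≤ up with settle uP (cnt N Q) ζ₀ up
  ... | ζ , ζ≤ζ₀ , ζ-up , ζ-low with select N Q (λ t → uP t + p * ζ t ∸ ζ (prev t))
                                      (λ t → m≤n+o⇒m∸n≤o (uP t + p * ζ t) (ζ (prev t)) (subst (uP t + p * ζ t ≤_) (+-comm (cnt N Q t) (ζ (prev t))) (ζ-up t)))
  ...   | P′ , P′≤Q , P′-zero , P′-cnt = record
    { P′ = P′ ; U′ = U′ ; σP′ = ζ ; σU′ = σU′ ; P′≤Q = P′≤Q ; conserve = conserve
    ; P′-carries = cP′ ; U′-carries = cU′ ; σP′≤ζ₀ = ζ≤ζ₀ ; σ-conserve = σ-conserve }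
    where
    U′ : ℕ → ℕ
    U′ n = P n + U n ∸ P′ n
    σU′ : T → ℕ
    σU′ t = σP t + σU t ∸ ζ t
    conserve : ∀ n → P′ n + U′ n ≡ P n + U n
    conserve n = m+[n∸m]≡n (≤-trans (P′≤Q n) (Q≤ n))
    σ-conserve : ∀ t → ζ t + σU′ t ≡ σP t + σU t
    σ-conserve t = m+[n∸m]≡n (≤-trans (ζ≤ζ₀ t) (ζ₀≤ t))
    cP′ : Carries (cnt N P′) ζ uP
    cP′ t = trans (cong (_+ ζ (prev t)) (P′-cnt t)) (m∸n+n≡m (ζ-low t))
    cnt-conserve : ∀ t → cnt N P′ t + cnt N U′ t ≡ cnt N P t + cnt N U t
    cnt-conserve t = trans (sym (cnt-+ N P′ U′ t)) (trans (cnt-cong N (λ n _ → conserve n) t) (cnt-+ N P U t))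
    regroup : ∀ p cP cU cP′ cU′ σP σU ζ σ′ sP sU z s′ uP uU →
      cU′ + s′ + (uU + p * σU + (uP + p * σP) + (cP′ + z) + (cP + cU) + (sP + sU) + p * (ζ + σ′)) ≡
      uU + p * σ′ + (cU + sU + (cP + sP) + (uP + p * ζ) + (cP′ + cU′) + (z + s′) + p * (σP + σU))
    regroup = solve-∀
    cU′ : Carries (cnt N U′) σU′ uU
    cU′ t = lin-≡ _ _
      (cong₂ _+_ (cong₂ _+_ (cong₂ _+_ (cong₂ _+_ (cong₂ _+_ (cU t) (cP t)) (sym (cP′ t))) (cnt-conserve t)) (σ-conserve (prev t))) (cong (p *_) (sym (σ-conserve t))))
      (regroup p (cnt N P t) (cnt N U t) (cnt N P′ t) (cnt N U′ t) (σP t) (σU t) (ζ t) (σU′ t) (σP (prev t)) (σU (prev t)) (ζ (prev t)) (σU′ (prev t)) (uP t) (uU t))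

  Valid : ℕ → ℕ → (ℕ → T → ℕ) → (ℕ → ℕ → ℕ) → (ℕ → T → ℕ) → Set
  Valid D N u A σ = ∀ g → g < D → Carries (cnt N (A g)) (σ g) (u g)

  Vanishing : ℕ → ℕ → (ℕ → ℕ → ℕ) → Set
  Vanishing D N A = ∀ g n → g < D → N ≤ n → A g n ≡ 0

  column : ℕ → (ℕ → ℕ → ℕ) → ℕ → ℕ
  column D A n = sumTo D (λ g → A g n)

  -- The degree in t of a summand: for `D = suc d` the weight of level `g` is `d ∸ g`.
  Φ : ℕ → ℕ → (ℕ → ℕ → ℕ) → ℕ
  Φ D N A = sumTo D (λ g → (D ∸ suc g) * val N (A g))

  -- `above` and `larger` together express growth in the reverse lexicographic order, decided at
  -- level `h`.
  record Improvement (D N : ℕ) (u : ℕ → T → ℕ) (A : ℕ → ℕ → ℕ) : Set where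
    field
      A′        : ℕ → ℕ → ℕ
      σ′        : ℕ → T → ℕ
      valid     : Valid D N u A′ σ′
      vanishing : Vanishing D N A′
      columns   : ∀ n → column D A′ n ≡ column D A n
      cheaper   : Φ D N A′ < Φ D N A
      h         : ℕ
      h<D       : h < D
      above     : ∀ g n → h < g → A′ g n ≡ A g n
      larger    : val N (A h) < val N (A′ h)

  record Exchanged (D N : ℕ) (u : ℕ → T → ℕ) (A : ℕ → ℕ → ℕ) (σ : ℕ → T → ℕ) (g : ℕ) (Q : ℕ → ℕ) (ζ₀ : T → ℕ) : Set where
    field
      A₁         : ℕ → ℕ → ℕ
      σ₁         : ℕ → T → ℕ
      valid      : Valid D N u A₁ σ₁
      vanishing  : Vanishing D N A₁
      columns    : ∀ n → column D A₁ n ≡ column D A n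
      cost       : Φ D N A₁ + val N (A g) ≡ Φ D N A + val N (A₁ g)
      A-other    : ∀ l → l ≢ g → l ≢ suc g → A₁ l ≡ A l
      σ-other    : ∀ l → l ≢ g → l ≢ suc g → σ₁ l ≡ σ l
      A₁≤Q       : ∀ n → A₁ g n ≤ Q n
      conserve   : ∀ n → A₁ g n + A₁ (suc g) n ≡ A g n + A (suc g) n
      σ₁≤ζ₀      : ∀ t → σ₁ g t ≤ ζ₀ t
      σ-conserve : ∀ t → σ₁ g t + σ₁ (suc g) t ≡ σ g t + σ (suc g) t

  -- The weights of the levels `g` and `suc g` differ by one, so `Φ` changes exactly by the change
  -- in the value of level `g`.
  exchange : ∀ {D N u A σ} g {Q ζ₀} → suc g < D → Valid D N u A σ → Vanishing D N A →
    (∀ n → Q n ≤ A g n + A (suc g) n) → (∀ t → ζ₀ t ≤ σ g t + σ (suc g) t) →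
    (∀ t → u g t + p * ζ₀ t ≤ cnt N Q t + ζ₀ (prev t)) → Exchanged D N u A σ g Q ζ₀
  exchange {D} {N} {u} {A} {σ} g {Q} {ζ₀} 1+g<D v z Q≤ ζ₀≤ up = record
    { A₁ = A₁ ; σ₁ = σ₁ ; valid = valid ; vanishing = vanishing ; columns = columns ; cost = cost
    ; A-other = replace-other A g P′ U′ ; σ-other = replace-other σ g σP′ σU′
    ; A₁≤Q = λ n → subst (_≤ Q n) (sym (A₁g n)) (P′≤Q n) ; conserve = A-conserve
    ; σ₁≤ζ₀ = λ t → subst (_≤ ζ₀ t) (sym (cong-app (replace-first σ g σP′ σU′) t)) (σP′≤ζ₀ t)
    ; σ-conserve = λ t → trans (cong₂ _+_ (cong-app (replace-first σ g σP′ σU′) t) (cong-app (replace-second σ g σP′ σU′) t)) (σ-conserve t) }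
    where
    open Redistributed (redistribute N (A g) (A (suc g)) Q {ζ₀ = ζ₀} (v g (<-trans ≤-refl 1+g<D)) (v (suc g) 1+g<D) Q≤ ζ₀≤ up)
    A₁ = replace A g P′ U′
    σ₁ = replace σ g σP′ σU′
    A₁g : ∀ n → A₁ g n ≡ P′ n
    A₁g = cong-app (replace-first A g P′ U′)
    A₁1+g : ∀ n → A₁ (suc g) n ≡ U′ n
    A₁1+g = cong-app (replace-second A g P′ U′)
    A-conserve : ∀ n → A₁ g n + A₁ (suc g) n ≡ A g n + A (suc g) n
    A-conserve n = trans (cong₂ _+_ (A₁g n) (A₁1+g n)) (conserve n)
    valid : Valid D N u A₁ σ₁
    valid l l<D with l ≟ g | l ≟ suc g
    ... | yes refl | _ = carries-cong (λ t → cong (λ a → cnt N a t) (sym (replace-first A l P′ U′))) (λ t → sym (cong-app (replace-first σ l σP′ σU′) t)) (λ _ → refl) P′-carries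
    ... | no _ | yes refl = carries-cong (λ t → cong (λ a → cnt N a t) (sym (replace-second A g P′ U′))) (λ t → sym (cong-app (replace-second σ g σP′ σU′) t)) (λ _ → refl) U′-carries
    ... | no ≢g | no ≢1+g = carries-cong (λ t → cong (λ a → cnt N a t) (sym (replace-other A g P′ U′ l ≢g ≢1+g))) (λ t → sym (cong-app (replace-other σ g σP′ σU′ l ≢g ≢1+g) t)) (λ _ → refl) (v l l<D)
    vanishing : Vanishing D N A₁
    vanishing l n l<D N≤n with l ≟ g | l ≟ suc g
    ... | yes refl | _ = m+n≡0⇒m≡0 _ (trans (A-conserve n) (cong₂ _+_ (z l n l<D N≤n) (z (suc l) n 1+g<D N≤n)))
    ... | no _ | yes refl = m+n≡0⇒n≡0 (A₁ g n) (trans (A-conserve n) (cong₂ _+_ (z g n (<-trans ≤-refl 1+g<D) N≤n) (z (suc g) n l<D N≤n)))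
    ... | no ≢g | no ≢1+g = trans (cong-app (replace-other A g P′ U′ l ≢g ≢1+g) n) (z l n l<D N≤n)
    columns : ∀ n → column D A₁ n ≡ column D A n
    columns n = +-cancelʳ-≡ 0 _ _ (pair-change D g (λ l → A₁ l n) (λ l → A l n) 0 0 1+g<D
      (λ l ≢g ≢1+g → cong-app (replace-other A g P′ U′ l ≢g ≢1+g) n) (cong (_+ 0) (A-conserve n)))
    val-conserve : val N (A₁ g) + val N (A₁ (suc g)) ≡ val N (A g) + val N (A (suc g))
    val-conserve = trans (sym (val-+ N (A₁ g) (A₁ (suc g)))) (trans (val-cong N (λ n _ → A-conserve n)) (val-+ N (A g) (A (suc g))))
    weight : D ∸ suc g ≡ suc (D ∸ suc (suc g))
    weight = +-∸-assoc 1 1+g<D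
    regroup : ∀ e a′ b′ a b → suc e * a′ + e * b′ + a + (e * (a + b)) ≡ suc e * a + e * b + a′ + (e * (a′ + b′))
    regroup = solve-∀
    cost : Φ D N A₁ + val N (A g) ≡ Φ D N A + val N (A₁ g)
    cost = pair-change D g (λ l → (D ∸ suc l) * val N (A₁ l)) (λ l → (D ∸ suc l) * val N (A l)) (val N (A g)) (val N (A₁ g)) 1+g<D
      (λ l ≢g ≢1+g → cong (λ a → (D ∸ suc l) * val N a) (replace-other A g P′ U′ l ≢g ≢1+g))
      (subst (λ w → w * val N (A₁ g) + (D ∸ suc (suc g)) * val N (A₁ (suc g)) + val N (A g) ≡ w * val N (A g) + (D ∸ suc (suc g)) * val N (A (suc g)) + val N (A₁ g)) (sym weight)
        (lin-≡ _ _ (cong ((D ∸ suc (suc g)) *_) val-conserve) (regroup (D ∸ suc (suc g)) (val N (A₁ g)) (val N (A₁ (suc g))) (val N (A g)) (val N (A (suc g))))))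

-- Improving a configuration by raising a coin one level.

module Improve (p : ℕ) (1<p : 1 < p) (f′ : ℕ) (ty : ℕ → Fin (suc f′)) where
  open Coins p 1<p f′ ty public

  strike : ℕ → (ℕ → ℕ) → ℕ → ℕ
  strike B a n with n ≟ B
  ... | yes _ = 0
  ... | no  _ = a n

  strike-≢ : ∀ {B a n} → n ≢ B → strike B a n ≡ a n
  strike-≢ {B} {a} {n} n≢B with n ≟ B
  ... | yes e = contradiction e n≢B
  ... | no _  = refl

  strike-at : ∀ B a → strike B a B ≡ 0
  strike-at B a with B ≟ B
  ... | yes _  = refl
  ... | no B≢B = contradiction refl B≢B

  strike≤ : ∀ B a n → strike B a n ≤ a n
  strike≤ B a n with n ≟ B
  ... | yes _ = z≤n
  ... | no  _ = ≤-refl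

  cnt-strike : ∀ B a t → cnt (suc B) (strike B a) t + δ (ty B) t * a B ≡ cnt (suc B) a t
  cnt-strike B a t = cong (_+ δ (ty B) t * a B) (trans (cong₂ _+_ (cnt-cong B (λ n n<B → strike-≢ (<⇒≢ n<B)) t)
    (trans (cong (δ (ty B) t *_) (strike-at B a)) (*-zeroʳ (δ (ty B) t)))) (+-identityʳ _))

  val-strike : ∀ B a → val (suc B) (strike B a) ≡ val B a
  val-strike B a = trans (cong₂ _+_ (val-cong B (λ n n<B → strike-≢ (<⇒≢ n<B))) (cong (_* p ^ B) (strike-at B a))) (+-identityʳ _)

  val-zero-top : ∀ B a → a B ≡ 0 → val (suc B) a ≡ val B a
  val-zero-top B a e = trans (cong (λ x → val B a + x * p ^ B) e) (+-identityʳ _)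

  cnt-unit : ∀ B t → cnt (suc B) (δℕ B) t ≡ δ (ty B) t
  cnt-unit B t = cong₂ _+_ (sumTo-0 B (λ l l<B → trans (cong (δ (ty l) t *_) (δℕ-≢ (>⇒≢ l<B))) (*-zeroʳ (δ (ty l) t))))
    (trans (cong (δ (ty B) t *_) (δℕ-refl B)) (*-identityʳ (δ (ty B) t)))

  val-unit : ∀ B → val (suc B) (δℕ B) ≡ p ^ B
  val-unit B = trans (cong₂ _+_ (sumTo-0 B (λ l l<B → cong (_* p ^ l) (δℕ-≢ (>⇒≢ l<B)))) (cong (_* p ^ B) (δℕ-refl B))) (+-identityʳ (p ^ B))

  -- The coin at position `B` is to go from level `i` to level `suc i`, where its subtraction
  -- borrows along `ι`. `slack` says that the carries this takes exist at some level, and `blocked`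
  -- allows them to be brought to level `suc i`.
  module Raise (D B : ℕ) (u : ℕ → T → ℕ) (A : ℕ → ℕ → ℕ) (σ : ℕ → T → ℕ)
    (valid : Valid D (suc B) u A σ) (vanishing : Vanishing D (suc B) A)
    (columns<p : ∀ n → n < suc B → column D A n < p)
    (blocked : ∀ {g g′} t → 1 ≤ g → g < g′ → g′ < D → u g t ≡ p ∸ 1 ⊎ (u g′ t ≡ 0 × σ g′ t ≡ 0))
    (i : ℕ) (h<D : suc i < D) (coin : 1 ≤ A i B) (highest : ∀ l → i < l → l < D → A l B ≡ 0)
    (slack : ∀ t → run (u (suc i)) (ty B) t ≤ sumTo D (λ l → σ l t)) where

    private
      N h : ℕ
      N = suc B
      h = suc i
      j : T
      j = ty B
      ι : T → ℕ
      ι = run (u h) j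

    carriesAbove : ℕ → T → ℕ
    carriesAbove g t = sumTo (suc h) (λ l → σ l t) ∸ sumTo (suc g) (λ l → σ l t)

    carriesAbove-step : ∀ g t → g < h → carriesAbove g t ≡ σ (suc g) t + carriesAbove (suc g) t
    carriesAbove-step g t g<h = +-cancelˡ-≡ (sumTo (suc g) S) _ _
      (trans (m+[n∸m]≡n (sumTo-prefix S (s≤s (<⇒≤ g<h))))
        (trans (sym (m+[n∸m]≡n (sumTo-prefix S (s≤s g<h)))) (+-assoc (sumTo (suc g) S) (S (suc g)) _)))
      where
      S : ℕ → ℕ
      S l = σ l t

    carriesAbove-top : ∀ t → carriesAbove h t ≡ 0
    carriesAbove-top t = n∸n≡0 (sumTo (suc h) (λ l → σ l t))

    carriesAbove-term : ∀ {g l} t → g < l → l ≤ h → σ l t ≤ carriesAbove g t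
    carriesAbove-term {g} {l} t g<l l≤h = m+n≤o⇒n≤o∸m′ (sumTo-gap (suc h) (λ l → σ l t) g<l (s≤s l≤h))
      where
      m+n≤o⇒n≤o∸m′ : ∀ {m n o} → m + n ≤ o → n ≤ o ∸ m
      m+n≤o⇒n≤o∸m′ {m} {n} {o} le = ≤-trans (≤-reflexive (sym (m+n∸m≡n m n))) (∸-monoˡ-≤ m le)

    carriesAbove-witness : ∀ {g} t → 0 < carriesAbove g t → ∃[ l ] (g < l × l ≤ h × 0 < σ l t)
    carriesAbove-witness {g} t pos with sumTo-grows (suc h) (λ l → σ l t) (suc g) (m<n∸o⇒o<n pos)
      where
      m<n∸o⇒o<n : ∀ {n o} → 0 < n ∸ o → o < n
      m<n∸o⇒o<n {suc n} {zero}  _  = z<s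
      m<n∸o⇒o<n {suc n} {suc o} lt = s<s (m<n∸o⇒o<n lt)
    ... | l , g<l , l<1+h , σ>0 = l , g<l , s≤s⁻¹ l<1+h , σ>0

    -- The part of the borrow that the levels `suc g` to `h` cannot cover with their own carries, so
    -- that the levels up to `g` have to pass it up.
    shortage : ℕ → T → ℕ
    shortage g t = ι t ∸ carriesAbove g t

    p>0 : 0 < p
    p>0 = <-trans z<s 1<p

    run-u>0 : ∀ {t} → Run (u h) j t → u h t ≢ p ∸ 1
    run-u>0 r e = <⇒≢ (m<n⇒0<n∸m 1<p) (trans (sym (run-zero r)) e)

    -- On the run `u h` is 0 and hence not `p ∸ 1`, so `blocked` rules out carries above `h`.
    slack-to-h : ∀ t → ι t ≤ sumTo (suc h) (λ l → σ l t)
    slack-to-h t = run≤ λ r → ≤-trans (subst (_≤ sumTo D (λ l → σ l t)) (run≡1 r) (slack t))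
      (≤-reflexive (sumTo-tail-zero D (suc h) (λ l → σ l t) h<D (λ l h<l l<D → higher r l h<l l<D)))
      where
      higher : Run (u h) j t → ∀ l → h < l → l < D → σ l t ≡ 0
      higher r l h<l l<D with blocked t (s≤s z≤n) h<l l<D
      ... | inj₁ e = contradiction e (run-u>0 r)
      ... | inj₂ (_ , e) = e

    shortage-first : ∀ t → shortage 0 t ≤ σ 0 t
    shortage-first t = m≤n+o⇒m∸n≤o (ι t) (carriesAbove 0 t) (≤-trans (slack-to-h t)
      (≤-reflexive (trans (sym (m+[n∸m]≡n (sumTo-prefix (λ l → σ l t) (s≤s z≤n)))) (+-comm (σ 0 t) (carriesAbove 0 t)))))

    shortage-next : ∀ g t → g < h → shortage (suc g) t ≤ σ (suc g) t + shortage g t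
    shortage-next g t g<h = m≤n+o⇒m∸n≤o (ι t) (carriesAbove (suc g) t) (≤-trans (m≤n+m∸n (ι t) (carriesAbove g t))
      (≤-reflexive (trans (cong (_+ shortage g t) (carriesAbove-step g t g<h)) (regroup (σ (suc g) t) (carriesAbove (suc g) t) (shortage g t)))))
      where
      regroup : ∀ a b c → a + b + c ≡ b + (a + c)
      regroup = solve-∀

    -- If level h has a smaller coin of type j, it can simply be swapped with the coin at position B.
    module Chain (noSwap : cnt N (A h) j ≡ 0) where

      -- Just above a run of shortages, level g + 1 has a coin of type s smaller than p ^ B to hand down to level g.
      available : ∀ g s → g < i → Run (u h) j (prev s) → carriesAbove g (prev s) ≡ 0 →
        (Run (u h) j s → 0 < carriesAbove g s) → 1 ≤ cnt N (strike B (A (suc g))) s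
      available g s g<i r none later = cases (carriesAbove g s) refl
        where
        1+g<h : suc g < h
        1+g<h = s≤s g<i
        σprev≡0 : ∀ l → g < l → l ≤ h → σ l (prev s) ≡ 0
        σprev≡0 l g<l l≤h = n≤0⇒n≡0 (subst (σ l (prev s) ≤_) none (carriesAbove-term (prev s) g<l l≤h))
        total≡ : ∀ l → g < l → l ≤ h → cnt N (A l) s ≡ u l s + p * σ l s
        total≡ l g<l l≤h = trans (sym (+-identityʳ _)) (trans (cong (cnt N (A l) s +_) (sym (σprev≡0 l g<l l≤h))) (valid l (≤-trans (s≤s l≤h) h<D) s))
        struck : ∀ {x} → x ≤ cnt N (A (suc g)) s → x ≤ cnt N (strike B (A (suc g))) s + δ j s * A (suc g) B
        struck le = ≤-trans le (≤-reflexive (sym (cnt-strike B (A (suc g)) s)))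
        fewer : ∀ {x} → x ≤ cnt N (A (suc g)) s → δ j s * A (suc g) B < x → 1 ≤ cnt N (strike B (A (suc g))) s
        fewer {x} le lt with cnt N (strike B (A (suc g))) s | struck le
        ... | zero  | le′ = contradiction le′ (<⇒≱ lt)
        ... | suc _ | _   = s≤s z≤n
        full : u (suc g) s ≡ p ∸ 1 → p ∸ 1 ≤ cnt N (A (suc g)) s
        full e = ≤-trans (≤-reflexive (sym e)) (≤-trans (m≤m+n (u (suc g) s) (p * σ (suc g) s)) (≤-reflexive (sym (total≡ (suc g) ≤-refl (<⇒≤ 1+g<h)))))
        p-1>0 : 0 < p ∸ 1
        p-1>0 = m<n⇒0<n∸m 1<p
        other : j ≢ s → u (suc g) s ≡ p ∸ 1 → 1 ≤ cnt N (strike B (A (suc g))) s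
        other j≢s e = fewer (full e) (subst (λ x → x * A (suc g) B < p ∸ 1) (sym (δ-≢ j≢s)) p-1>0)
        cases : ∀ x → carriesAbove g s ≡ x → 1 ≤ cnt N (strike B (A (suc g))) s
        -- By `later`, digit `s` is outside the run. So `u h s` is not 0 and the digit `s` of level
        -- `suc g` is full; moreover `s` is not `j`, because a nonempty run contains `j`.
        cases zero eq with blocked s (s≤s z≤n) 1+g<h h<D
        ... | inj₁ e = other (λ { refl → ¬r (run-nonempty r) }) e
          where
          ¬r : ¬ Run (u h) j s
          ¬r r′ = contradiction eq (>⇒≢ (later r′))
        ... | inj₂ (e , _) = contradiction (subst (0 <_) eq (later (step r e))) (<-irrefl refl)
        cases (suc x) eq with carriesAbove-witness {g} s (subst (0 <_) (sym eq) z<s)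
        ... | l , g<l , l≤h , σ>0 with suc g ≟ l
        -- A carry at level `suc g` itself takes at least `p` coins of type `s`, and fewer than `p`
        -- coins lie at position `B`.
        ...   | yes refl = fewer {p} (≤-trans (≤-trans (≤-reflexive (sym (*-identityʳ p))) (*-monoʳ-≤ p σ>0)) (≤-trans (m≤n+m _ (u l s)) (≤-reflexive (sym (total≡ l g<l l≤h)))))
                (≤-trans (s≤s (δ*≤ (A l B))) (≤-trans (s≤s (term≤sumTo D (λ g → A g B) (≤-trans (s≤s l≤h) h<D))) (columns<p B ≤-refl)))
          where
          δ*≤ : ∀ x → δ j s * x ≤ x
          δ*≤ x with j F.≟ s
          ... | yes _ = ≤-reflexive (+-identityʳ x)
          ... | no _  = z≤n
        ...   | no 1+g≢l with blocked s (s≤s z≤n) (≤∧≢⇒< g<l 1+g≢l) (≤-trans (s≤s l≤h) h<D)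
        ...     | inj₂ (_ , σ≡0) = contradiction σ≡0 (>⇒≢ σ>0)
        ...     | inj₁ e = split (j F.≟ s)
          where
          split : Dec (j ≡ s) → 1 ≤ cnt N (strike B (A (suc g))) s
          split (no j≢s) = other j≢s e
          split (yes refl) with suc g ≟ i
          -- Level `i` also holds a coin at position `B`, so at most `p ∸ 2` of the coins there
          -- belong to level `suc g`, which has at least `p ∸ 1` coins of type `j`.
          ... | no 1+g≢i = fewer (full e) (subst (λ x → x * A (suc g) B < p ∸ 1) (sym (δ-refl j)) (subst (_< p ∸ 1) (sym (+-identityʳ _)) few))
            where
            few : A (suc g) B < p ∸ 1
            few = ≤-trans (≤-trans (≤-reflexive (+-comm 1 (A (suc g) B))) (≤-trans (+-monoʳ-≤ (A (suc g) B) coin) (two-terms≤sumTo D (λ l → A l B) (≤∧≢⇒< g<i 1+g≢i) (<⇒≤ h<D))))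
              (∸-monoˡ-≤ 1 (columns<p B ≤-refl))
          -- Now `l` is `h`: a carry there without an incoming one takes coins of type `j`, against
          -- `noSwap`.
          ... | yes refl with ≤-antisym l≤h (≤∧≢⇒< g<l 1+g≢l)
          ...   | refl = contradiction (trans (sym (total≡ h g<l ≤-refl)) noSwap) (>⇒≢ (≤-trans (≤-trans σ>0 (m≤n*m (σ h s) p ⦃ >-nonZero p>0 ⦄)) (m≤n+m _ (u h s))))

      -- Giving up a carry at `prev s` costs level `g` one unit at `s`. Either the level gives up a
      -- carry at `s` as well, which frees `p` units, or it is repaid with a smaller coin of type
      -- `s` from level `suc g`.
      demand : ∀ g s → g < i → shortage g (prev s) ≤ p * shortage g s + cnt N (strike B (A (suc g))) s
      demand g s g<i = cases (carriesAbove g (prev s)) (run? (u h) j (prev s)) refl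
        where
        later : ∀ x → shortage g s ≡ x → Run (u h) j (prev s) → carriesAbove g (prev s) ≡ 0 →
          1 ≤ p * shortage g s + cnt N (strike B (A (suc g))) s
        later (suc x) e r none = ≤-trans (≤-trans p>0 (m≤m*n p (shortage g s) ⦃ >-nonZero (subst (0 <_) (sym e) z<s) ⦄)) (m≤m+n _ _)
        later zero    e r none = ≤-trans (available g s g<i r none (λ r′ → ≤-trans (≤-reflexive (sym (run≡1 r′))) (m∸n≡0⇒m≤n e))) (m≤n+m _ (p * shortage g s))
        cases : ∀ x → Dec (Run (u h) j (prev s)) → carriesAbove g (prev s) ≡ x →
          shortage g (prev s) ≤ p * shortage g s + cnt N (strike B (A (suc g))) s
        cases x       (no ¬r) e = ≤-trans (m∸n≤m (ι (prev s)) (carriesAbove g (prev s))) (≤-trans (≤-reflexive (run≡0 ¬r)) z≤n)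
        cases (suc x) (yes r) e = ≤-trans (≤-reflexive (m≤n⇒m∸n≡0 (≤-trans (run≤1 (u h) j (prev s)) (subst (1 ≤_) (sym e) (s≤s z≤n))))) z≤n
        cases zero    (yes r) e = ≤-trans (≤-trans (m∸n≤m (ι (prev s)) (carriesAbove g (prev s))) (run≤1 (u h) j (prev s))) (later (shortage g s) refl r e)

      -- Invariant of the pass through the levels 0 to `g`. Level `g` has gathered the whole
      -- shortage, each level passed has been charged at most once for its coins below position `B`,
      -- and `keeps` saves the coin for the last exchange.
      record Stage (g : ℕ) : Set where
        field
          A₁         : ℕ → ℕ → ℕ
          σ₁         : ℕ → T → ℕ
          valid₁     : Valid D N u A₁ σ₁
          vanishing₁ : Vanishing D N A₁
          columns₁   : ∀ n → column D A₁ n ≡ column D A n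
          A-rest     : ∀ l → g < l → A₁ l ≡ A l
          σ-rest     : ∀ l → g < l → σ₁ l ≡ σ l
          covers     : ∀ t → shortage g t ≤ σ₁ g t
          keeps      : A g B ≤ A₁ g B
          cost₁      : Φ D N A₁ ≤ Φ D N A + sumTo (suc g) (λ l → val B (A l))

      stage : ∀ g → g ≤ i → Stage g
      stage zero _ = record
        { A₁ = A ; σ₁ = σ ; valid₁ = valid ; vanishing₁ = vanishing ; columns₁ = λ _ → refl
        ; A-rest = λ _ _ → refl ; σ-rest = λ _ _ → refl ; covers = shortage-first ; keeps = ≤-refl ; cost₁ = m≤m+n _ _ }
      stage (suc g) g<i = record
        { A₁ = E.A₁ ; σ₁ = E.σ₁ ; valid₁ = E.valid ; vanishing₁ = E.vanishing
        ; columns₁ = λ n → trans (E.columns n) (columns₁ n)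
        ; A-rest = λ l 1+g<l → trans (E.A-other l (>⇒≢ (<-trans ≤-refl 1+g<l)) (>⇒≢ 1+g<l)) (A-rest l (<-trans ≤-refl 1+g<l))
        ; σ-rest = λ l 1+g<l → trans (E.σ-other l (>⇒≢ (<-trans ≤-refl 1+g<l)) (>⇒≢ 1+g<l)) (σ-rest l (<-trans ≤-refl 1+g<l))
        ; covers = covers′ ; keeps = keeps′ ; cost₁ = cost′ }
        where
        open Stage (stage g (<⇒≤ g<i))
        next : A₁ (suc g) ≡ A (suc g)
        next = A-rest (suc g) ≤-refl
        σ-next : σ₁ (suc g) ≡ σ (suc g)
        σ-next = σ-rest (suc g) ≤-refl
        low : ℕ → ℕ
        low = strike B (A (suc g))
        Q : ℕ → ℕ
        Q n = A₁ g n + low n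
        -- The shortage is reserved for level `suc g`; in return level `g` may draw on the smaller
        -- coins of that level.
        ζ₀ : T → ℕ
        ζ₀ t = σ₁ g t ∸ shortage g t
        ζ₀+ : ∀ t → ζ₀ t + shortage g t ≡ σ₁ g t
        ζ₀+ t = m∸n+n≡m (covers t)
        g<h : g < h
        g<h = <-trans g<i ≤-refl
        regroup : ∀ p uu z zp x xp s sp e l →
          uu + p * z + (p * x + l + (e + sp) + p * s + (zp + xp)) ≡ e + l + zp + (xp + (uu + p * s) + p * (z + x) + sp)
        regroup = solve-∀
        up : ∀ t → u g t + p * ζ₀ t ≤ cnt N Q t + ζ₀ (prev t)
        up t = subst (λ c → u g t + p * ζ₀ t ≤ c + ζ₀ (prev t)) (sym (cnt-+ N (A₁ g) low t))
          (lin-≤ _ _ (+-mono-≤ (+-mono-≤ (+-mono-≤ (demand g t g<i) (≤-reflexive (sym (valid₁ g (<-trans g<h h<D) t)))) (≤-reflexive (cong (p *_) (ζ₀+ t)))) (≤-reflexive (sym (ζ₀+ (prev t)))))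
            (regroup p (u g t) (ζ₀ t) (ζ₀ (prev t)) (shortage g t) (shortage g (prev t)) (σ₁ g t) (σ₁ g (prev t)) (cnt N (A₁ g) t) (cnt N low t)))
        E : Exchanged D N u A₁ σ₁ g Q ζ₀
        E = exchange g (<-trans (s≤s g<i) h<D) valid₁ vanishing₁
          (λ n → +-monoʳ-≤ (A₁ g n) (≤-trans (strike≤ B (A (suc g)) n) (≤-reflexive (sym (cong-app next n)))))
          (λ t → ≤-trans (m∸n≤m (σ₁ g t) (shortage g t)) (m≤m+n _ _)) up
        module E = Exchanged E
        covers′ : ∀ t → shortage (suc g) t ≤ E.σ₁ (suc g) t
        covers′ t = ≤-trans (shortage-next g t g<h)
          (lin-≤ _ _ (+-mono-≤ (+-mono-≤ (E.σ₁≤ζ₀ t) (≤-reflexive (ζ₀+ t))) (≤-reflexive (sym (trans (E.σ-conserve t) (cong (σ₁ g t +_) (cong-app σ-next t))))))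
            (rearrange (σ (suc g) t) (shortage g t) (E.σ₁ g t) (E.σ₁ (suc g) t) (ζ₀ t) (σ₁ g t)))
          where
          rearrange : ∀ s x a b z r → s + x + (z + r + (a + b)) ≡ b + (a + (z + x) + (r + s))
          rearrange = solve-∀
        keeps′ : A (suc g) B ≤ E.A₁ (suc g) B
        keeps′ = lin-≤ _ _ (+-mono-≤ (E.A₁≤Q B) (≤-reflexive (sym (trans (E.conserve B) (cong (A₁ g B +_) (cong-app next B))))))
          (subst (λ x → A (suc g) B + (A₁ g B + x + (E.A₁ g B + E.A₁ (suc g) B)) ≡ E.A₁ (suc g) B + (E.A₁ g B + (A₁ g B + A (suc g) B))) (sym (strike-at B (A (suc g))))
            (rearrange (A (suc g) B) (A₁ g B) (E.A₁ g B) (E.A₁ (suc g) B)))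
          where
          rearrange : ∀ a q x y → a + (q + 0 + (x + y)) ≡ y + (x + (q + a))
          rearrange = solve-∀
        cost′ : Φ D N E.A₁ ≤ Φ D N A + sumTo (suc (suc g)) (λ l → val B (A l))
        cost′ = lin-≤ _ _ (+-mono-≤ (+-mono-≤ (≤-reflexive E.cost) (val-mono N E.A₁≤Q)) cost₁)
          (subst₂ (λ x y → Φ D N E.A₁ + (Φ D N A₁ + val N (E.A₁ g) + x + (Φ D N A + sumTo (suc g) (λ l → val B (A l)))) ≡ Φ D N A + (sumTo (suc g) (λ l → val B (A l)) + y) + (Φ D N E.A₁ + val N (A₁ g) + val N (E.A₁ g) + Φ D N A₁))
            (sym (val-+ N (A₁ g) low)) (val-strike B (A (suc g)))
            (rearrange (Φ D N E.A₁) (Φ D N A₁) (val N (E.A₁ g)) (val N (A₁ g)) (val N low) (Φ D N A) (sumTo (suc g) (λ l → val B (A l)))))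
          where
          rearrange : ∀ φ′ φ₁ v′ v l φ s → φ′ + (φ₁ + v′ + (v + l) + (φ + s)) ≡ φ + (s + l) + (φ′ + v + v′ + φ₁)
          rearrange = solve-∀

    -- The coin at position B is kept out of the pool offered to level i, so it ends up on level h.
    raise-last : ∀ A₁ σ₁ → Valid D N u A₁ σ₁ → Vanishing D N A₁ → (∀ n → column D A₁ n ≡ column D A n) →
      (∀ l → i < l → A₁ l ≡ A l) → A i B ≤ A₁ i B → Φ D N A₁ ≤ Φ D N A + sumTo (suc i) (λ l → val B (A l)) →
      ∀ ζ₀ → (∀ t → ζ₀ t ≤ σ₁ i t + σ₁ h t) →
      (∀ t → u i t + p * ζ₀ t + δ j t ≤ cnt N (A₁ i) t + cnt N (A h) t + ζ₀ (prev t)) →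
      Improvement D N u A
    raise-last A₁ σ₁ valid₁ vanishing₁ columns₁ A-rest keeps cost₁ ζ₀ ζ₀≤ up = record
      { A′ = E.A₁ ; σ′ = E.σ₁ ; valid = E.valid ; vanishing = E.vanishing
      ; columns = λ n → trans (E.columns n) (columns₁ n) ; cheaper = cheaper′ ; h = h ; h<D = h<D
      ; above = λ g n h<g → cong-app (trans (E.A-other g (>⇒≢ (<-trans ≤-refl h<g)) (>⇒≢ h<g)) (A-rest g (<-trans ≤-refl h<g))) n
      ; larger = larger′ }
      where
      next : A₁ h ≡ A h
      next = A-rest h ≤-refl
      AhB≡0 : A h B ≡ 0
      AhB≡0 = highest h ≤-refl h<D
      rest : ℕ → ℕ
      rest n = A₁ i n ∸ δℕ B n
      rest+ : ∀ n → rest n + δℕ B n ≡ A₁ i n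
      rest+ n with B ≟ n
      ... | yes refl = m∸n+n≡m (≤-trans coin keeps)
      ... | no _     = +-identityʳ _
      Q : ℕ → ℕ
      Q n = rest n + A h n
      cnt-rest : ∀ t → cnt N rest t + δ j t ≡ cnt N (A₁ i) t
      cnt-rest t = trans (cong (cnt N rest t +_) (sym (cnt-unit B t))) (trans (sym (cnt-+ N rest (δℕ B) t)) (cnt-cong N (λ n _ → rest+ n) t))
      val-rest : val N rest + p ^ B ≡ val N (A₁ i)
      val-rest = trans (cong (val N rest +_) (sym (val-unit B))) (trans (sym (val-+ N rest (δℕ B))) (val-cong N (λ n _ → rest+ n)))
      up′ : ∀ t → u i t + p * ζ₀ t ≤ cnt N Q t + ζ₀ (prev t)
      up′ t = subst (λ c → u i t + p * ζ₀ t ≤ c + ζ₀ (prev t)) (sym (cnt-+ N rest (A h) t))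
        (lin-≤ _ _ (+-mono-≤ (up t) (≤-reflexive (sym (cnt-rest t)))) (rearrange (u i t + p * ζ₀ t) (δ j t) (cnt N (A₁ i) t) (cnt N rest t) (cnt N (A h) t) (ζ₀ (prev t))))
        where
        rearrange : ∀ x d a r b z → x + (a + b + z + (r + d)) ≡ r + b + z + (x + d + a)
        rearrange = solve-∀
      E : Exchanged D N u A₁ σ₁ i Q ζ₀
      E = exchange i h<D valid₁ vanishing₁
        (λ n → +-mono-≤ (m∸n≤m (A₁ i n) (δℕ B n)) (≤-reflexive (sym (cong-app next n)))) ζ₀≤ up′
      module E = Exchanged E
      -- All columns are below `p`, so the coins below position `B` are together worth less than
      -- `p ^ B`. Moving them down one level costs less than raising the one coin gains.
      lower : sumTo D (λ l → val B (A l)) < p ^ B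
      lower = subst (_< p ^ B) (trans (sumTo-cong B (λ n _ → sym (sumTo-*ʳ D (p ^ n) (λ l → A l n)))) (sumTo-comm B D (λ n l → A l n * p ^ n)))
        (val< B (column D A) (λ n n<B → columns<p n (m<n⇒m<1+n n<B)))
      cheaper′ : Φ D N E.A₁ < Φ D N A
      cheaper′ = lin-≤ _ _ (+-mono-≤ (+-mono-≤ (+-mono-≤ (+-mono-≤ (≤-reflexive E.cost) (val-mono N E.A₁≤Q)) cost₁)
          (≤-trans (s≤s (sumTo-prefix (λ l → val B (A l)) h<D)) lower)) (≤-reflexive val-rest))
        (subst (λ x → suc (Φ D N E.A₁) + (Φ D N A₁ + val N (E.A₁ i) + x + (Φ D N A + sumTo (suc i) (λ l → val B (A l))) + p ^ B + val N (A₁ i)) ≡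
            Φ D N A + (Φ D N E.A₁ + val N (A₁ i) + val N (E.A₁ i) + Φ D N A₁ + suc (sumTo (suc h) (λ l → val B (A l))) + (val N rest + p ^ B)))
          (sym (trans (val-+ N rest (A h)) (cong (val N rest +_) (val-zero-top B (A h) AhB≡0))))
          (rearrange (Φ D N E.A₁) (Φ D N A₁) (val N (E.A₁ i)) (val N rest) (val B (A h)) (Φ D N A) (sumTo (suc i) (λ l → val B (A l))) (p ^ B) (val N (A₁ i))))
        where
        rearrange : ∀ φ′ φ₁ v′ r b φ s P v → suc φ′ + (φ₁ + v′ + (r + b) + (φ + s) + P + v) ≡ φ + (φ′ + v + v′ + φ₁ + suc (s + b) + (r + P))
        rearrange = solve-∀
      top : 1 ≤ E.A₁ h B
      top = lin-≤ _ _ (+-mono-≤ (+-mono-≤ (E.A₁≤Q B) (≤-reflexive (rest+ B))) (≤-reflexive (sym (trans (E.conserve B) (cong (A₁ i B +_) (cong-app next B))))))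
        (subst (λ x → 1 + (rest B + A h B + A₁ i B + (E.A₁ i B + E.A₁ h B)) ≡ E.A₁ h B + (E.A₁ i B + (rest B + x) + (A₁ i B + A h B))) (sym (δℕ-refl B))
          (rearrange (rest B) (A h B) (A₁ i B) (E.A₁ i B) (E.A₁ h B)))
        where
        rearrange : ∀ r b a x y → 1 + (r + b + a + (x + y)) ≡ y + (x + (r + 1) + (a + b))
        rearrange = solve-∀
      larger′ : val N (A h) < val N (E.A₁ h)
      larger′ = subst (_< val N (E.A₁ h)) (sym (val-zero-top B (A h) AhB≡0))
        (≤-trans (val< B (A h) (λ n n<B → ≤-<-trans (term≤sumTo D (λ l → A l n) h<D) (columns<p n (m<n⇒m<1+n n<B))))
          (≤-trans (≤-trans (≤-reflexive (sym (+-identityʳ (p ^ B)))) (*-monoˡ-≤ (p ^ B) top)) (m≤n+m _ (val B (E.A₁ h)))))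

    raise : Improvement D N u A
    raise with cnt N (A h) j in noSwap
    -- Trading coins of equal type leaves the carries alone, so the allowance `σ i` suffices.
    ... | suc x = raise-last A σ valid vanishing (λ _ → refl) (λ _ _ → refl) ≤-refl (m≤m+n _ _) (σ i) (λ t → m≤m+n _ _)
        (λ t → lin-≤ _ _ (+-mono-≤ (≤-reflexive (sym (valid i (<⇒≤ h<D) t))) (δ≤ t))
          (rearrange (u i t + p * σ i t) (δ j t) (cnt N (A i) t) (cnt N (A h) t) (σ i (prev t))))
      where
      δ≤ : ∀ t → δ j t ≤ cnt N (A h) t
      δ≤ t = split (j F.≟ t)
        where
        split : Dec (j ≡ t) → δ j t ≤ cnt N (A h) t
        split (yes refl) = ≤-trans (δ≤1 j j) (subst (1 ≤_) (sym noSwap) (s≤s z≤n))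
        split (no j≢t)   = ≤-trans (≤-reflexive (δ-≢ j≢t)) z≤n
      rearrange : ∀ x d a b s → x + d + (a + s + b) ≡ a + b + s + (x + d)
      rearrange = solve-∀
    ... | zero = raise-last S.A₁ S.σ₁ S.valid₁ S.vanishing₁ S.columns₁ S.A-rest S.keeps S.cost₁ ζ₀
        (λ t → m∸n≤m (σ₂ t) (ι t)) up
      where
      module S = Chain.Stage (Chain.stage noSwap i ≤-refl)
      σ₂ : T → ℕ
      σ₂ t = S.σ₁ i t + S.σ₁ h t
      -- Level `h` is left with at least `ι`, the borrow for its new coin; by `run-borrow` level `i`
      -- manages with the rest.
      ζ₀ : T → ℕ
      ζ₀ t = σ₂ t ∸ ι t
      σh : ∀ t → S.σ₁ h t ≡ σ h t
      σh = cong-app (S.σ-rest h ≤-refl)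
      ι≤ : ∀ t → ι t ≤ σ₂ t
      ι≤ t = ≤-trans (m≤n+m∸n (ι t) (carriesAbove i t)) (≤-trans (+-mono-≤ (≤-reflexive above≡) (S.covers t)) (≤-reflexive (+-comm (S.σ₁ h t) (S.σ₁ i t))))
        where
        above≡ : carriesAbove i t ≡ S.σ₁ h t
        above≡ = trans (carriesAbove-step i t ≤-refl) (trans (cong (σ h t +_) (carriesAbove-top t)) (trans (+-identityʳ _) (sym (σh t))))
      ζ₀+ : ∀ t → ζ₀ t + ι t ≡ σ₂ t
      ζ₀+ t = m∸n+n≡m (ι≤ t)
      up : ∀ t → u i t + p * ζ₀ t + δ j t ≤ cnt N (S.A₁ i) t + cnt N (A h) t + ζ₀ (prev t)
      up t = lin-≤ _ _ (+-mono-≤ (+-mono-≤ (+-mono-≤ (+-mono-≤ (run-borrow (u h) j t) (≤-reflexive (sym (S.valid₁ i (<⇒≤ h<D) t))))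
             (≤-reflexive (sym valid-h))) (≤-reflexive (cong (p *_) (ζ₀+ t)))) (≤-reflexive (sym (ζ₀+ (prev t)))))
          (rearrange p (u i t) (u h t) (ζ₀ t) (ι t) (ζ₀ (prev t)) (ι (prev t)) (δ j t) (cnt N (S.A₁ i) t) (cnt N (A h) t) (S.σ₁ i t) (S.σ₁ h t) (S.σ₁ i (prev t)) (S.σ₁ h (prev t)))
        where
        valid-h : cnt N (A h) t + S.σ₁ h (prev t) ≡ u h t + p * S.σ₁ h t
        valid-h = subst (λ a → cnt N a t + S.σ₁ h (prev t) ≡ u h t + p * S.σ₁ h t) (S.A-rest h ≤-refl) (S.valid₁ h h<D t)
        rearrange : ∀ p a b z x zp xp d e k s r sp rp →
          a + p * z + d + (b + p * x + (e + sp) + (k + rp) + p * (s + r) + (zp + xp)) ≡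
          e + k + zp + (d + xp + (a + p * s) + (b + p * r) + p * (z + x) + (sp + rp))
        rearrange = solve-∀

-- Comparing two configurations coin by coin.

only : ℕ → ℕ → ℕ → ℕ
only i g x with i ≟ g
... | yes _ = x
... | no  _ = 0

only-refl : ∀ i x → only i i x ≡ x
only-refl i x with i ≟ i
... | yes _  = refl
... | no i≢i = contradiction refl i≢i

only-≢ : ∀ {i g} x → i ≢ g → only i g x ≡ 0
only-≢ {i} {g} x i≢g with i ≟ g
... | yes e = contradiction e i≢g
... | no _  = refl

only-0 : ∀ i g → only i g 0 ≡ 0
only-0 i g with i ≟ g
... | yes _ = refl
... | no  _ = refl

sumTo-only : ∀ n i x → i < n → sumTo n (λ l → only i l x) ≡ x
sumTo-only (suc n) i x (s≤s i≤n) with i ≟ n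
... | yes refl = cong (_+ x) (sumTo-0 n (λ l l<n → only-≢ x (>⇒≢ l<n)))
... | no i≢n   = trans (+-identityʳ _) (sumTo-only n i x (≤∧≢⇒< i≤n i≢n))

last-positive : ∀ n (F : ℕ → ℕ) → 0 < sumTo n F → ∃[ i ] (i < n × 1 ≤ F i × (∀ l → i < l → l < n → F l ≡ 0))
last-positive (suc n) F pos with F n in eq
... | suc x = n , ≤-refl , subst (1 ≤_) (sym eq) (s≤s z≤n) , (λ l n<l l≤n → contradiction n<l (≤⇒≯ (s≤s⁻¹ l≤n)))
... | zero with last-positive n F (subst (0 <_) (+-identityʳ _) pos)
...   | i , i<n , Fi , after = i , m<n⇒m<1+n i<n , Fi , after′
  where
  after′ : ∀ l → i < l → l < suc n → F l ≡ 0
  after′ l i<l (s≤s l≤n) with l ≟ n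
  ... | yes refl = eq
  ... | no l≢n   = after l i<l (≤∧≢⇒< l≤n l≢n)

module Compare (p : ℕ) (1<p : 1 < p) (f′ : ℕ) (ty : ℕ → Fin (suc f′)) (D : ℕ) where
  open Improve p 1<p f′ ty public

  -- Coins enter only through their numbers by type, since carries see nothing else; a completion
  -- stands for any way of dealing the remaining coins.
  record Completion (u : ℕ → T → ℕ) (tot : T → ℕ) (E σ : ℕ → T → ℕ) : Set where
    constructor completion
    field
      carries : ∀ g → g < D → Carries (E g) (σ g) (u g)
      totals  : ∀ t → sumTo D (λ g → E g t) ≡ tot t

  carried : (ℕ → T → ℕ) → T → ℕ
  carried σ t = sumTo D (λ g → σ g t)

  -- Summed over all levels, the carry equations become a single cyclic system determined by `u` and
  -- `tot`.
  carried-unique : ∀ {u tot E E′ σ σ′} → Completion u tot E σ → Completion u tot E′ σ′ → ∀ t → carried σ t ≡ carried σ′ t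
  carried-unique {u} {tot} c c′ = carries-unique (sum-carries c) (sum-carries c′)
    where
    sum-carries : ∀ {E σ} → Completion u tot E σ → Carries tot (carried σ) (carried u)
    sum-carries {E} {σ} c t = trans (cong (_+ carried σ (prev t)) (sym (Completion.totals c t)))
      (trans (sym (sumTo-+ D (λ g → E g t) (λ g → σ g (prev t))))
        (trans (sumTo-cong D (λ g g<D → Completion.carries c g g<D t))
          (trans (sumTo-+ D (λ g → u g t) (λ g → p * σ g t)) (cong (carried u t +_) (sumTo-* D p (λ g → σ g t))))))

  -- A digit of level g ≥ 1 has been touched only after the higher levels were shut out of that digit for good.
  Ordered : (ℕ → T → ℕ) → (T → ℕ) → Set
  Ordered u tot = ∀ {g g′} t → 1 ≤ g → g < g′ → g′ < D →
    u g t ≡ p ∸ 1 ⊎ (u g′ t ≡ 0 × (∀ {E σ} → Completion u tot E σ → σ g′ t ≡ 0))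

  module _ {u tot} (ordered : Ordered u tot) where

    zero-mono : ∀ {g g′} → 1 ≤ g → g ≤ g′ → g′ < D → ∀ t → u g t ≡ 0 → u g′ t ≡ 0
    zero-mono {g} {g′} 1≤g g≤g′ g′<D t e with g ≟ g′
    ... | yes refl = e
    ... | no g≢g′ with ordered t 1≤g (≤∧≢⇒< g≤g′ g≢g′) g′<D
    ...   | inj₁ e′ = contradiction (trans (sym e) e′) (<⇒≢ (m<n⇒0<n∸m 1<p))
    ...   | inj₂ (e′ , _) = e′

    blocked-at : ∀ {E σ} → Completion u tot E σ → ∀ {g g′} t → 1 ≤ g → g < g′ → g′ < D → u g t ≡ p ∸ 1 ⊎ (u g′ t ≡ 0 × σ g′ t ≡ 0)
    blocked-at c t 1≤g g<g′ g′<D with ordered t 1≤g g<g′ g′<D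
    ... | inj₁ e       = inj₁ e
    ... | inj₂ (e , s) = inj₂ (e , s c)

  module Spend (u : ℕ → T → ℕ) (i : ℕ) (j : T) where
    borrowed : ℕ → T → ℕ
    borrowed g t = only i g (run (u i) j t)

    spent : ℕ → T → ℕ
    spent g t = only i g (δ j t)

    -- Subtraction with cyclic borrow; by `spend-≤` the truncated difference is exact.
    after : ℕ → T → ℕ
    after g t = u g t + p * borrowed g t ∸ (spent g t + borrowed g (prev t))

    spend-≤ : ∀ g t → spent g t + borrowed g (prev t) ≤ u g t + p * borrowed g t
    spend-≤ g t with i ≟ g
    ... | yes refl = run-borrow (u i) j t
    ... | no _     = z≤n

    spend-≡ : ∀ g t → after g t + (spent g t + borrowed g (prev t)) ≡ u g t + p * borrowed g t
    spend-≡ g t = m∸n+n≡m (spend-≤ g t)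

    after-other : ∀ {g} → i ≢ g → ∀ t → after g t ≡ u g t
    after-other {g} i≢g t rewrite only-≢ {i} {g} (run (u i) j t) i≢g | only-≢ {i} {g} (δ j t) i≢g | only-≢ {i} {g} (run (u i) j (prev t)) i≢g | *-zeroʳ p = +-identityʳ _

    after≡0 : ∀ {g} t → u g t ≡ 0 → borrowed g t ≡ 0 → after g t ≡ 0
    after≡0 {g} t e e′ rewrite e | e′ | *-zeroʳ p = 0∸n≡0 (spent g t + borrowed g (prev t))

    after-untouched : ∀ t → j ≢ t → ¬ Run (u i) j (prev t) → after i t ≡ u i t
    after-untouched t j≢t ¬r = go (λ r → not (run-inv r))
      where
      not : ¬ (j ≡ t ⊎ Run (u i) j (prev t))
      not (inj₁ e) = j≢t e
      not (inj₂ r) = ¬r r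
      go : ¬ Run (u i) j t → after i t ≡ u i t
      go ¬r′ rewrite only-refl i (run (u i) j t) | only-refl i (δ j t) | only-refl i (run (u i) j (prev t))
        | δ-≢ j≢t | run≡0 ¬r | run≡0 ¬r′ | *-zeroʳ p = +-identityʳ _

    unspend : ∀ g {E σ} → Carries E σ (after g) → Carries (λ t → E t + spent g t) (λ t → σ t + borrowed g t) (u g)
    unspend g {E} {σ} c t = lin-≡ _ _ (cong₂ _+_ (c t) (spend-≡ g t))
      (regroup p (E t) (spent g t) (σ (prev t)) (borrowed g (prev t)) (u g t) (σ t) (borrowed g t) (after g t))
      where
      regroup : ∀ p E s σp bp u σ b a → E + s + (σp + bp) + (a + p * σ + (u + p * b)) ≡ u + p * (σ + b) + (E + σp + (a + (s + bp)))
      regroup = solve-∀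

    spend : ∀ g {E σ} → Carries (λ t → E t + spent g t) (λ t → σ t + borrowed g t) (u g) → Carries E σ (after g)
    spend g {E} {σ} c t = lin-≡ _ _ (cong₂ _+_ (c t) (sym (spend-≡ g t)))
      (regroup p (E t) (spent g t) (σ (prev t)) (borrowed g (prev t)) (u g t) (σ t) (borrowed g t) (after g t))
      where
      regroup : ∀ p E s σp bp u σ b a → E + σp + (u + p * (σ + b) + (a + (s + bp))) ≡ a + p * σ + (E + s + (σp + bp) + (u + p * b))
      regroup = solve-∀

    borrowed≤ : ∀ {E σ} → Carries E σ (u i) → 1 ≤ E j → ∀ t → run (u i) j t ≤ σ t
    borrowed≤ c pos t = run≤ (run-carries c pos)

    completion-unspend : ∀ {tot tot′ E σ} → i < D → (∀ t → tot′ t + δ j t ≡ tot t) → Completion after tot′ E σ →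
      Completion u tot (λ g t → E g t + spent g t) (λ g t → σ g t + borrowed g t)
    completion-unspend {E = E} i<D tot≡ c = completion (λ g g<D → unspend g (Completion.carries c g g<D))
      (λ t → trans (sumTo-+ D (λ g → E g t) (λ g → spent g t)) (trans (cong₂ _+_ (Completion.totals c t) (sumTo-only D i (δ j t) i<D)) (tot≡ t)))

    -- If level i + 1 cannot take the coin, then b stops every borrow of the higher levels before it leaves the digits that level i touches.
    ordered-after : ∀ {tot tot′ E σ} → Ordered u tot → Completion u tot E σ → i < D → 1 ≤ E i j → (∀ t → tot′ t + δ j t ≡ tot t) →
      (suc i < D → ∃[ b ] (Run (u (suc i)) j b × carried σ b ≡ 0)) → Ordered after tot′
    ordered-after {tot} {tot′} {E} {σ} ordered c i<D pos tot≡ stuck {g} {g′} t 1≤g g<g′ g′<D with ordered t 1≤g g<g′ g′<D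
    -- What was shut stays shut: restoring the coin and its borrow turns a completion of `after`
    -- into one of `u`.
    ... | inj₂ (e , s) = inj₂ (after≡0 t e (n≤0⇒n≡0 (subst (borrowed g′ t ≤_) (s c) (borrowed≤σ g′))) ,
                               λ c′ → m+n≡0⇒m≡0 _ (s (completion-unspend i<D tot≡ c′)))
      where
      borrowed≤σ : ∀ g → borrowed g t ≤ σ g t
      borrowed≤σ g with i ≟ g
      ... | yes refl = borrowed≤ (Completion.carries c i i<D) pos t
      ... | no _     = z≤n
    ... | inj₁ e = touched (i ≟ g)
      where
      touched : Dec (i ≡ g) → after g t ≡ p ∸ 1 ⊎ (after g′ t ≡ 0 × (∀ {E σ} → Completion after tot′ E σ → σ g′ t ≡ 0))
      touched (no i≢g)   = inj₁ (trans (after-other i≢g t) e)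
      touched (yes refl) = split (j F.≟ t) (run? (u i) j (prev t))
        where
        1+i<D : suc i < D
        1+i<D = ≤-trans (s≤s g<g′) g′<D
        b = proj₁ (stuck 1+i<D)
        run-b : Run (u (suc i)) j b
        run-b = proj₁ (proj₂ (stuck 1+i<D))
        none : carried σ b ≡ 0
        none = proj₂ (proj₂ (stuck 1+i<D))
        reach : ∀ {t} → j ≡ t ⊎ Run (u i) j (prev t) → Below (u (suc i)) b t
        reach-run : ∀ {t} → Run (u i) j t → Below (u (suc i)) b t
        reach (inj₁ refl) = run⇒below run-b
        -- Level `i` carries at every digit of its run and nothing is carried at `b`. So the run
        -- never contains `b`, and every digit it touches still leads up to `b`.
        reach (inj₂ r) = below-step (reach-run r)
          (λ e → contradiction (sumTo-zero⇒term D (λ g → σ g b) none i i<D) (>⇒≢ (subst (λ s → 1 ≤ σ i s) e (run-carries (Completion.carries c i i<D) pos r))))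
        reach-run (start _)  = run⇒below run-b
        reach-run (step r _) = reach (inj₂ r)
        shut : Below (u (suc i)) b t → after g′ t ≡ 0 × (∀ {E σ} → Completion after tot′ E σ → σ g′ t ≡ 0)
        shut q = trans (after-other (<⇒≢ g<g′) t) (proj₁ (block c)) , λ c′ → m+n≡0⇒m≡0 _ (proj₂ (block (completion-unspend i<D tot≡ c′)))
          where
          block : ∀ {E σ} → Completion u tot E σ → u g′ t ≡ 0 × σ g′ t ≡ 0
          -- By `carried-unique`, no completion at all carries at `b`.
          block {E′} {σ′} c′ = below-blocked (Completion.carries c′ g′ g′<D) (zero-mono ordered (s≤s z≤n) g<g′ g′<D)
            (sumTo-zero⇒term D (λ g → σ′ g b) (trans (carried-unique c′ c b) none) g′ g′<D) q
        split : Dec (j ≡ t) → Dec (Run (u i) j (prev t)) →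
          after i t ≡ p ∸ 1 ⊎ (after g′ t ≡ 0 × (∀ {E σ} → Completion after tot′ E σ → σ g′ t ≡ 0))
        split (yes e′)  _       = inj₂ (shut (reach (inj₁ e′)))
        split (no _)   (yes r)  = inj₂ (shut (reach (inj₂ r)))
        split (no j≢t) (no ¬r)  = inj₁ (trans (after-untouched t j≢t ¬r) e)

    module Coin (B : ℕ) (j≡ : j ≡ ty B) (i<D : i < D) where
      unit : ℕ → ℕ → ℕ
      unit g n = only i g (δℕ B n)

      cnt-unit′ : ∀ g t → cnt (suc B) (unit g) t ≡ spent g t
      cnt-unit′ g t with i ≟ g
      ... | yes _ = trans (cnt-unit B t) (cong (λ s → δ s t) (sym j≡))
      ... | no  _ = sumTo-0 (suc B) (λ l _ → *-zeroʳ (δ (ty l) t))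

      unit-vanishing : ∀ g n → suc B ≤ n → unit g n ≡ 0
      unit-vanishing g n B<n = trans (cong (only i g) (δℕ-≢ (<⇒≢ B<n))) (only-0 i g)

      remove : (ℕ → ℕ → ℕ) → ℕ → ℕ → ℕ
      remove A g n = A g n ∸ unit g n

      remove+ : ∀ A → 1 ≤ A i B → ∀ g n → remove A g n + unit g n ≡ A g n
      remove+ A coin g n = m∸n+n≡m (unit≤ g n)
        where
        unit≤ : ∀ g n → unit g n ≤ A g n
        unit≤ g n with i ≟ g
        ... | no _ = z≤n
        ... | yes refl with B ≟ n
        ...   | yes refl = coin
        ...   | no _     = z≤n

      cnt-remove : ∀ A → 1 ≤ A i B → ∀ g t → cnt (suc B) (remove A g) t + spent g t ≡ cnt (suc B) (A g) t
      cnt-remove A coin g t = trans (cong (cnt (suc B) (remove A g) t +_) (sym (cnt-unit′ g t)))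
        (trans (sym (cnt-+ (suc B) (remove A g) (unit g) t)) (cnt-cong (suc B) (λ n _ → remove+ A coin g n) t))

      column-remove : ∀ A → 1 ≤ A i B → ∀ n → column D (remove A) n + column D unit n ≡ column D A n
      column-remove A coin n = trans (sym (sumTo-+ D (λ g → remove A g n) (λ g → unit g n))) (sumTo-cong D (λ g _ → remove+ A coin g n))

      val-remove : ∀ A → 1 ≤ A i B → ∀ g → val (suc B) (remove A g) + val (suc B) (unit g) ≡ val (suc B) (A g)
      val-remove A coin g = trans (sym (val-+ (suc B) (remove A g) (unit g))) (val-cong (suc B) (λ n _ → remove+ A coin g n))

      lessσ : (ℕ → T → ℕ) → ℕ → T → ℕ
      lessσ σ g t = σ g t ∸ borrowed g t

      valid-remove : ∀ {A σ} → 1 ≤ A i B → 1 ≤ cnt (suc B) (A i) j → Valid D (suc B) u A σ → Valid D (suc B) after (remove A) (lessσ σ)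
      valid-remove {A} {σ} coin pos v g g<D = spend g (carries-cong (λ t → sym (cnt-remove A coin g t)) (λ t → sym (m∸n+n≡m (borrowed≤σ t))) (λ _ → refl) (v g g<D))
        where
        borrowed≤σ : ∀ t → borrowed g t ≤ σ g t
        borrowed≤σ t with i ≟ g
        ... | yes refl = borrowed≤ (v i i<D) pos t
        ... | no _     = z≤n

      Φ-+ : ∀ A → Φ D (suc B) (λ g n → A g n + unit g n) ≡ Φ D (suc B) A + Φ D (suc B) unit
      Φ-+ A = trans (sumTo-cong D (λ g _ → trans (cong ((D ∸ suc g) *_) (val-+ (suc B) (A g) (unit g))) (*-distribˡ-+ (D ∸ suc g) _ _)))
        (sumTo-+ D (λ g → (D ∸ suc g) * val (suc B) (A g)) (λ g → (D ∸ suc g) * val (suc B) (unit g)))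

      Φ-remove : ∀ A → 1 ≤ A i B → Φ D (suc B) (remove A) + Φ D (suc B) unit ≡ Φ D (suc B) A
      Φ-remove A coin = trans (sym (Φ-+ (remove A))) (sumTo-cong D (λ g _ → cong ((D ∸ suc g) *_) (val-cong (suc B) (λ n _ → remove+ A coin g n))))

      -- The same coin is added on both sides at the same level and position, so all differences
      -- persist.
      improvement-restore : ∀ {A} → 1 ≤ A i B → Improvement D (suc B) after (remove A) → Improvement D (suc B) u A
      improvement-restore {A} coin imp = record
        { A′ = λ g n → I.A′ g n + unit g n
        ; σ′ = λ g t → I.σ′ g t + borrowed g t
        ; valid = λ g g<D → carries-cong (λ t → trans (cong (cnt (suc B) (I.A′ g) t +_) (sym (cnt-unit′ g t))) (sym (cnt-+ (suc B) (I.A′ g) (unit g) t))) (λ _ → refl) (λ _ → refl) (unspend g (I.valid g g<D))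
        ; vanishing = λ g n g<D B<n → cong₂ _+_ (I.vanishing g n g<D B<n) (unit-vanishing g n B<n)
        ; columns = λ n → trans (sumTo-+ D (λ g → I.A′ g n) (λ g → unit g n)) (trans (cong (_+ column D unit n) (I.columns n)) (column-remove A coin n))
        ; cheaper = subst₂ _<_ (sym (Φ-+ I.A′)) (Φ-remove A coin) (+-monoˡ-< (Φ D (suc B) unit) I.cheaper)
        ; h = I.h ; h<D = I.h<D
        ; above = λ g n h<g → trans (cong (_+ unit g n) (I.above g n h<g)) (remove+ A coin g n)
        ; larger = subst₂ _<_ (val-remove A coin I.h) (sym (val-+ (suc B) (I.A′ I.h) (unit I.h))) (+-monoˡ-< (val (suc B) (unit I.h)) I.larger) }
        where module I = Improvement imp

  cnt-top : ∀ B {a : ℕ → ℕ} → a B ≡ 0 → ∀ t → cnt (suc B) a t ≡ cnt B a t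
  cnt-top B {a} e t = trans (cong (λ x → cnt B a t + δ (ty B) t * x) e) (trans (cong (cnt B a t +_) (*-zeroʳ (δ (ty B) t))) (+-identityʳ _))

  Φ-top : ∀ B A → (∀ g → g < D → A g B ≡ 0) → Φ D (suc B) A ≡ Φ D B A
  Φ-top B A z = sumTo-cong D (λ g g<D → cong ((D ∸ suc g) *_) (val-zero-top B (A g) (z g g<D)))

  improvement-extend : ∀ {B u A} → (∀ g → g < D → A g B ≡ 0) → Improvement D B u A → Improvement D (suc B) u A
  improvement-extend {B} {u} {A} z imp = record
    { A′ = I.A′ ; σ′ = I.σ′
    ; valid = λ g g<D → carries-cong (λ t → sym (cnt-top B (z′ g g<D) t)) (λ _ → refl) (λ _ → refl) (I.valid g g<D)
    ; vanishing = λ g n g<D B<n → I.vanishing g n g<D (<⇒≤ B<n)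
    ; columns = I.columns ; cheaper = subst₂ _<_ (sym (Φ-top B I.A′ z′)) (sym (Φ-top B A z)) I.cheaper
    ; h = I.h ; h<D = I.h<D ; above = I.above
    ; larger = subst₂ _<_ (sym (val-zero-top B (A I.h) (z I.h I.h<D))) (sym (val-zero-top B (I.A′ I.h) (z′ I.h I.h<D))) I.larger }
    where
    module I = Improvement imp
    z′ : ∀ g → g < D → I.A′ g B ≡ 0
    z′ g g<D = I.vanishing g B g<D ≤-refl

  Comparison : ℕ → (ℕ → T → ℕ) → (A C : ℕ → ℕ → ℕ) → Set
  Comparison N u A C = Improvement D N u A ⊎ Improvement D N u C ⊎ (∀ g n → g < D → A g n ≡ C g n)

  record Configuration (N : ℕ) (u : ℕ → T → ℕ) (tot : T → ℕ) (A : ℕ → ℕ → ℕ) (σ : ℕ → T → ℕ) : Set where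
    field
      valid     : Valid D N u A σ
      vanishing : Vanishing D N A
      columns<p : ∀ n → column D A n < p
      totals    : ∀ t → sumTo D (λ g → cnt N (A g) t) ≡ tot t

    complete : Completion u tot (λ g → cnt N (A g)) σ
    complete = completion valid totals

  cnt-coin : ∀ B a → 1 ≤ a B → 1 ≤ cnt (suc B) a (ty B)
  cnt-coin B a coin = ≤-trans (≤-trans coin (≤-reflexive (trans (sym (+-identityʳ (a B))) (cong (_* a B) (sym (δ-refl (ty B))))))) (m≤n+m _ (cnt B a (ty B)))

  raisable : ∀ {B u tot A σ i} → Ordered u tot → Configuration (suc B) u tot A σ → suc i < D → 1 ≤ A i B →
    (∀ l → i < l → l < D → A l B ≡ 0) → (∀ t → run (u (suc i)) (ty B) t ≤ carried σ t) → Improvement D (suc B) u A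
  raisable {B} {u} {tot} {A} {σ} {i} ordered K 1+i<D coin highest slack =
    Raise.raise D B u A σ valid vanishing (λ n _ → columns<p n) (λ t 1≤g → blocked-at ordered complete t 1≤g) i 1+i<D coin highest slack
    where open Configuration K

  -- `C` itself proves that there are enough carries: its coin at level `i′` forces carries along
  -- the run there, which contains the run of level `suc i`, and the total carries of `A` and `C`
  -- agree.
  outranked : ∀ {B u tot A σ C τ i i′} → Ordered u tot → Configuration (suc B) u tot A σ → Configuration (suc B) u tot C τ →
    i < i′ → i′ < D → 1 ≤ A i B → (∀ l → i < l → l < D → A l B ≡ 0) → 1 ≤ C i′ B → Improvement D (suc B) u A
  outranked {B} {u} {C = C} {τ} {i} {i′} ordered K L i<i′ i′<D coin highest coin′ =
    raisable ordered K (≤-<-trans i<i′ i′<D) coin highest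
      (λ t → run≤ λ r → ≤-trans (run-carries (valid L i′ i′<D) (cnt-coin B (C i′) coin′) (run-mono (zero-mono ordered (s≤s z≤n) i<i′ i′<D) r))
        (≤-trans (term≤sumTo D (λ g → τ g t) i′<D) (≤-reflexive (carried-unique (complete L) (complete K) t))))
    where open Configuration

  -- Recursion on the position, then on the number `c` of coins left at it. If the topmost coins
  -- there are on different levels, the lower one can be raised. If they share a level, the coin of
  -- `A` can be raised, or else it is dealt in both configurations and `ordered-after` maintains the
  -- invariant.
  comparison : ∀ N {u tot A σ C τ} → Ordered u tot → Configuration N u tot A σ → Configuration N u tot C τ →
    (∀ n → column D A n ≡ column D C n) → Comparison N u A C
  peel : ∀ B c {u tot A σ C τ} → Ordered u tot → Configuration (suc B) u tot A σ → Configuration (suc B) u tot C τ →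
    (∀ n → column D A n ≡ column D C n) → column D A B ≡ c → Comparison (suc B) u A C

  comparison zero    _ K L _ = inj₂ (inj₂ λ g n g<D → trans (vanishing K g n g<D z≤n) (sym (vanishing L g n g<D z≤n)))
    where open Configuration
  comparison (suc B) ordered K L same = peel B _ ordered K L same refl

  peel B zero {u} {tot} {A} {σ} {C} {τ} ordered K L same none with comparison B ordered (lower K zA) (lower L zC) same
    where
    open Configuration
    zA : ∀ g → g < D → A g B ≡ 0
    zA = sumTo-zero⇒term D (λ g → A g B) none
    zC : ∀ g → g < D → C g B ≡ 0
    zC = sumTo-zero⇒term D (λ g → C g B) (trans (sym (same B)) none)
    lower : ∀ {A σ} → Configuration (suc B) u tot A σ → (∀ g → g < D → A g B ≡ 0) → Configuration B u tot A σ
    lower {A} K z = record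
      { valid = λ g g<D → carries-cong (cnt-top B (z g g<D)) (λ _ → refl) (λ _ → refl) (valid K g g<D)
      ; vanishing = vanishing′ ; columns<p = columns<p K
      ; totals = λ t → trans (sumTo-cong D (λ g g<D → sym (cnt-top B (z g g<D) t))) (totals K t) }
      where
      vanishing′ : Vanishing D B A
      vanishing′ g n g<D B≤n with B ≟ n
      ... | yes refl = z g g<D
      ... | no B≢n   = vanishing K g n g<D (≤∧≢⇒< B≤n B≢n)
  ... | inj₁ imp        = inj₁ (improvement-extend (sumTo-zero⇒term D (λ g → A g B) none) imp)
  ... | inj₂ (inj₁ imp) = inj₂ (inj₁ (improvement-extend (sumTo-zero⇒term D (λ g → C g B) (trans (sym (same B)) none)) imp))
  ... | inj₂ (inj₂ eq)  = inj₂ (inj₂ eq)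
  peel B (suc c) {u} {tot} {A} {σ} {C} {τ} ordered K L same some
    with last-positive D (λ g → A g B) (subst (0 <_) (sym some) z<s) | last-positive D (λ g → C g B) (subst (0 <_) (sym (trans (sym (same B)) some)) z<s)
  ... | i , i<D , coin , highest | i′ , i′<D , coin′ , highest′ with <-cmp i i′
  ...   | tri< i<i′ _ _ = inj₁ (outranked ordered K L i<i′ i′<D coin highest coin′)
  ...   | tri> _ _ i′<i = inj₂ (inj₁ (outranked ordered L K i′<i i<D coin′ highest′ coin))
  ...   | tri≈ _ refl _ = decide (suc i <? D) (FP.all? (λ t → run (u (suc i)) (ty B) t ≤? carried σ t))
    where
    open Configuration
    j = ty B
    open Spend u i j
    open Coin B refl i<D
    tot′ : T → ℕ
    tot′ t = sumTo D (λ g → cnt (suc B) (remove A g) t)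
    tot≡ : ∀ {A} → 1 ≤ A i B → ∀ t → sumTo D (λ g → cnt (suc B) (remove A g) t) + δ j t ≡ sumTo D (λ g → cnt (suc B) (A g) t)
    tot≡ {A} coin t = trans (cong (sumTo D (λ g → cnt (suc B) (remove A g) t) +_) (sym (sumTo-only D i (δ j t) i<D)))
      (trans (sym (sumTo-+ D (λ g → cnt (suc B) (remove A g) t) (λ g → spent g t))) (sumTo-cong D (λ g _ → cnt-remove A coin g t)))
    shrink : ∀ {A σ} → 1 ≤ A i B → Configuration (suc B) u tot A σ → (∀ t → sumTo D (λ g → cnt (suc B) (remove A g) t) ≡ tot′ t) →
      Configuration (suc B) after tot′ (remove A) (lessσ σ)
    shrink {A} coin K e = record
      { valid = valid-remove coin (cnt-coin B (A i) coin) (valid K)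
      ; vanishing = λ g n g<D B<n → n≤0⇒n≡0 (≤-trans (m∸n≤m (A g n) (unit g n)) (≤-reflexive (vanishing K g n g<D B<n)))
      ; columns<p = λ n → ≤-<-trans (m+n≤o⇒m≤o _ (≤-reflexive (column-remove A coin n))) (columns<p K n)
      ; totals = e }
    recurse : (suc i < D → ∃[ b ] (Run (u (suc i)) j b × carried σ b ≡ 0)) → Comparison (suc B) u A C
    recurse stuck with peel B c
        (ordered-after ordered (complete K) i<D (cnt-coin B (A i) coin) (λ t → trans (tot≡ coin t) (totals K t)) stuck)
        (shrink coin K (λ _ → refl))
        (shrink coin′ L (λ t → +-cancelʳ-≡ (δ j t) _ _ (trans (tot≡ coin′ t) (trans (totals L t) (sym (trans (tot≡ coin t) (totals K t)))))))
        (λ n → +-cancelʳ-≡ (column D unit n) _ _ (trans (column-remove A coin n) (trans (same n) (sym (column-remove C coin′ n)))))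
        (+-cancelʳ-≡ 1 _ _ (trans (trans (cong (column D (remove A) B +_) (sym one)) (column-remove A coin B)) (trans some (+-comm 1 c))))
      where
      one : column D unit B ≡ 1
      one = trans (sumTo-only D i (δℕ B B) i<D) (δℕ-refl B)
    ... | inj₁ imp        = inj₁ (improvement-restore coin imp)
    ... | inj₂ (inj₁ imp) = inj₂ (inj₁ (improvement-restore coin′ imp))
    ... | inj₂ (inj₂ eq)  = inj₂ (inj₂ λ g n g<D → trans (sym (remove+ A coin g n)) (trans (cong (_+ unit g n) (eq g n g<D)) (remove+ C coin′ g n)))
    decide : Dec (suc i < D) → Dec (∀ t → run (u (suc i)) (ty B) t ≤ carried σ t) → Comparison (suc B) u A C
    decide (yes 1+i<D) (yes slack) = inj₁ (raisable ordered K 1+i<D coin highest slack)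
    decide (no 1+i≮D)  _           = recurse (λ 1+i<D → contradiction 1+i<D 1+i≮D)
    decide (yes 1+i<D) (no ¬slack) with FP.¬∀⟶∃¬ _ _ (λ t → run (u (suc i)) (ty B) t ≤? carried σ t) ¬slack
    -- A run indicator is at most 1, so it fails to be covered only where it is 1 and nothing is
    -- carried.
    ... | b , ≰ = recurse (λ _ → b , run-pos (≤-<-trans z≤n (≰⇒> ≰)) , n<1⇒n≡0 (≤-trans (≰⇒> ≰) (run≤1 (u (suc i)) j b)))

-- Vectors, the reverse lexicographic order and base-p digits.

sumTo-head : ∀ n (F : ℕ → ℕ) → sumTo (suc n) F ≡ F 0 + sumTo n (λ l → F (suc l))
sumTo-head zero    F = sym (+-identityʳ (F 0))
sumTo-head (suc n) F = trans (cong (_+ F (suc n)) (sumTo-head n F)) (+-assoc (F 0) _ _)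

-- Out of range, the entry is 0.
at : ∀ {n} → Vec ℕ n → ℕ → ℕ
at []       g       = 0
at (x ∷ xs) zero    = x
at (x ∷ xs) (suc g) = at xs g

at-lookup : ∀ {n} (xs : Vec ℕ n) i → at xs (toℕ i) ≡ lookup xs i
at-lookup (x ∷ xs) fzero    = refl
at-lookup (x ∷ xs) (fsuc i) = at-lookup xs i

at-ext : ∀ {n} (xs ys : Vec ℕ n) → (∀ g → g < n → at xs g ≡ at ys g) → xs ≡ ys
at-ext []       []       h = refl
at-ext (x ∷ xs) (y ∷ ys) h = cong₂ _∷_ (h 0 z<s) (at-ext xs ys (λ g g<n → h (suc g) (s<s g<n)))

toVec : ∀ n → (ℕ → ℕ) → Vec ℕ n
toVec n F = tabulate (λ i → F (toℕ i))

at-toVec : ∀ n F g → g < n → at (toVec n F) g ≡ F g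
at-toVec (suc n) F zero    _         = refl
at-toVec (suc n) F (suc g) (s≤s g<n) = at-toVec n (λ l → F (suc l)) g g<n

sum-toVec : ∀ n F → sum (toVec n F) ≡ sumTo n F
sum-toVec zero    F = refl
sum-toVec (suc n) F = trans (cong (F 0 +_) (sum-toVec n (λ l → F (suc l)))) (sym (sumTo-head n F))

sum-map-at : ∀ {n} (φ : ℕ → ℕ) (xs : Vec ℕ n) → sum (Vec.map φ xs) ≡ sumTo n (λ g → φ (at xs g))
sum-map-at         φ []       = refl
sum-map-at {suc n} φ (x ∷ xs) = trans (cong (φ x +_) (sum-map-at φ xs)) (sym (sumTo-head n (λ g → φ (at (x ∷ xs) g))))

sum-at : ∀ {n} (xs : Vec ℕ n) → sum xs ≡ sumTo n (at xs)
sum-at []               = refl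
sum-at {suc n} (x ∷ xs) = trans (cong (x +_) (sum-at xs)) (sym (sumTo-head n (at (x ∷ xs))))

tdeg-at : ∀ d (m : Vec ℕ (suc d)) → tdeg d m ≡ sumTo (suc d) (λ g → (d ∸ g) * at m g)
tdeg-at d m = trans (cong sum (VecP.tabulate-cong (λ i → cong ((d ∸ toℕ i) *_) (sym (at-lookup m i)))))
  (sum-toVec (suc d) (λ g → (d ∸ g) * at m g))

<lex-∷ʳ : ∀ {n} {xs ys : Vec ℕ n} x y → xs <lex ys → (xs ∷ʳ x) <lex (ys ∷ʳ y)
<lex-∷ʳ {xs = []}    {[]}    x y ()
<lex-∷ʳ {xs = _ ∷ _} {_ ∷ _} x y (inj₁ lt)       = inj₁ lt
<lex-∷ʳ {xs = _ ∷ _} {_ ∷ _} x y (inj₂ (e , lt)) = inj₂ (e , <lex-∷ʳ x y lt)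

<lex-last : ∀ {n} (xs : Vec ℕ n) {x y} → x < y → (xs ∷ʳ x) <lex (xs ∷ʳ y)
<lex-last []       lt = inj₁ lt
<lex-last (_ ∷ xs) lt = inj₂ (refl , <lex-last xs lt)

-- `reverse` moves the head to the end: for positive `h` it comes after the decisive entry, and for
-- `h = 0` it is that entry.
reverse-<lex : ∀ {n} (xs ys : Vec ℕ n) h → at xs h < at ys h → (∀ g → h < g → g < n → at xs g ≡ at ys g) → reverse xs <lex reverse ys
reverse-<lex (x ∷ xs) (y ∷ ys) h lt same rewrite VecP.reverse-∷ x xs | VecP.reverse-∷ y ys with h
... | suc h = <lex-∷ʳ x y (reverse-<lex xs ys h lt (λ g h<g g<n → same (suc g) (s<s h<g) (s<s g<n)))
... | zero rewrite at-ext xs ys (λ g g<n → same (suc g) z<s (s<s g<n)) = <lex-last (reverse ys) lt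

-- Allows `k` itself to serve as the number of positions for the digits of `k`.
n<p^n : ∀ {p} → 1 < p → ∀ n → n < p ^ n
n<p^n 1<p zero = z<s
n<p^n {p} 1<p (suc n) = ≤-trans (+-mono-≤ (≤-trans z<s ih) ih) (≤-trans (≤-reflexive (cong (p ^ n +_) (sym (+-identityʳ (p ^ n))))) (*-monoˡ-≤ (p ^ n) 1<p))
  where ih = n<p^n 1<p n

module Digits (b : ℕ) (1<p : 1 < suc b) where
  p = suc b

  digit<p : ∀ j n → digit p j n < p
  digit<p zero    n = m%n<n n p
  digit<p (suc j) n = digit<p j (n / p)

  digit-0 : ∀ j → digit p j 0 ≡ 0
  digit-0 zero    = refl
  digit-0 (suc j) = trans (cong (digit p j) (0/n≡0 p)) (digit-0 j)

  split-digit : ∀ n → n ≡ n % p + p * (n / p)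
  split-digit n = trans (m≡m%n+[m/n]*n n p) (cong (n % p +_) (*-comm (n / p) p))

  shift< : ∀ N n → n < p ^ suc N → n / p < p ^ N
  shift< N n lt = m<n*o⇒m/o<n {n} {p ^ N} {p} (subst (n <_) (*-comm p (p ^ N)) lt)

  digit-beyond : ∀ N n m → m < p ^ N → N ≤ n → digit p n m ≡ 0
  digit-beyond zero    n       m (s≤s z≤n) _         = digit-0 n
  digit-beyond (suc N) (suc n) m lt        (s≤s N≤n) = digit-beyond N n (m / p) (shift< N m lt) N≤n

  low%p : ∀ x v → x < p → (x + p * v) % p ≡ x
  low%p x v x<p = trans (cong (λ y → (x + y) % p) (*-comm p v)) (trans ([m+kn]%n≡m%n x v p) (m<n⇒m%n≡m x<p))

  low/p : ∀ x v → x < p → (x + p * v) / p ≡ v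
  low/p x v x<p = *-cancelˡ-≡ _ v p (+-cancelˡ-≡ x _ _ (trans (cong (_+ p * ((x + p * v) / p)) (sym (low%p x v x<p))) (sym (split-digit (x + p * v)))))

-- Divisibility by `q ∸ 1` in terms of carries.

module Levels (b : ℕ) (1<p : 1 < suc b) (f′ : ℕ) (d : ℕ) where
  open Digits b 1<p
  f = suc f′
  D = suc d

  ty : ℕ → Fin f
  ty n = n mod f

  open Compare p 1<p f′ ty D

  val-horner : ∀ N a → val (suc N) a ≡ a 0 + p * val N (λ n → a (suc n))
  val-horner N a = trans (sumTo-head N (λ n → a n * p ^ n)) (cong₂ _+_ (*-identityʳ (a 0))
    (trans (sumTo-cong N (λ n _ → rearrange (a (suc n)) p (p ^ n))) (sumTo-* N p (λ n → a (suc n) * p ^ n))))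
    where
    rearrange : ∀ x p y → x * (p * y) ≡ p * (x * y)
    rearrange = solve-∀

  val-digit : ∀ N m → m < p ^ N → val N (λ n → digit p n m) ≡ m
  val-digit zero    m (s≤s z≤n) = refl
  val-digit (suc N) m lt = trans (val-horner N (λ n → digit p n m))
    (trans (cong (λ v → m % p + p * v) (val-digit N (m / p) (shift< N m lt))) (sym (split-digit m)))

  digit-val : ∀ N a → (∀ n → a n < p) → (∀ n → N ≤ n → a n ≡ 0) → ∀ j → digit p j (val N a) ≡ a j
  digit-val zero    a a<p zero-above j = trans (digit-0 j) (sym (zero-above j z≤n))
  digit-val (suc N) a a<p zero-above j with val (suc N) a | val-horner N a
  digit-val (suc N) a a<p zero-above zero    | _ | refl = low%p (a 0) _ (a<p 0)
  digit-val (suc N) a a<p zero-above (suc j) | _ | refl = trans (cong (digit p j) (low/p (a 0) _ (a<p 0)))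
    (digit-val N (λ n → a (suc n)) (λ n → a<p (suc n)) (λ n N≤n → zero-above (suc n) (s≤s N≤n)) j)

  -- The value modulo p ^ n ∸ 1 of a vector of coins.
  V : ∀ {n} → (Fin n → ℕ) → ℕ
  V {zero}  u = 0
  V {suc n} u = u fzero + p * V (λ i → u (fsuc i))

  V-cong : ∀ {n} {u v : Fin n → ℕ} → (∀ i → u i ≡ v i) → V u ≡ V v
  V-cong {zero}  h = refl
  V-cong {suc n} h = cong₂ (λ x y → x + p * y) (h fzero) (V-cong (λ i → h (fsuc i)))

  V-+ : ∀ {n} (u v : Fin n → ℕ) → V (λ i → u i + v i) ≡ V u + V v
  V-+ {zero}  u v = refl
  V-+ {suc n} u v = trans (cong (λ y → u fzero + v fzero + p * y) (V-+ (λ i → u (fsuc i)) (λ i → v (fsuc i))))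
    (rearrange (u fzero) (v fzero) p (V (λ i → u (fsuc i))) (V (λ i → v (fsuc i))))
    where
    rearrange : ∀ x y p a b → x + y + p * (a + b) ≡ x + p * a + (y + p * b)
    rearrange = solve-∀

  V-* : ∀ {n} c (u : Fin n → ℕ) → V (λ i → c * u i) ≡ c * V u
  V-* {zero}  c u = sym (*-zeroʳ c)
  V-* {suc n} c u = trans (cong (λ y → c * u fzero + p * y) (V-* c (λ i → u (fsuc i)))) (rearrange c (u fzero) p (V (λ i → u (fsuc i))))
    where
    rearrange : ∀ c x p a → c * x + p * (c * a) ≡ c * (x + p * a)
    rearrange = solve-∀

  V-0 : ∀ {n} {u : Fin n → ℕ} → (∀ i → u i ≡ 0) → V u ≡ 0
  V-0 {zero}  h = refl
  V-0 {suc n} h = cong₂ _+_ (h fzero) (trans (cong (p *_) (V-0 (λ i → h (fsuc i)))) (*-zeroʳ p))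

  V-δ : ∀ {n} (j : Fin n) x → V (λ i → δ j i * x) ≡ x * p ^ toℕ j
  V-δ {suc n} fzero x = trans (cong₂ _+_ (trans (cong (_* x) (δ-refl {suc n} fzero)) (+-identityʳ x)) (trans (cong (p *_) (V-0 {n} (λ i → cong (_* x) (δ-≢ {i = fzero} {fsuc i} λ ())))) (*-zeroʳ p)))
    (trans (+-identityʳ x) (sym (*-identityʳ x)))
  V-δ {suc n} (fsuc j) x = trans (cong₂ _+_ (cong (_* x) (δ-≢ {i = fsuc j} {fzero} λ ())) (cong (p *_) (trans (V-cong (λ i → cong (_* x) (δ-suc i))) (V-δ j x))))
    (rearrange x p (p ^ toℕ j))
    where
    δ-suc : ∀ i → δ (fsuc j) (fsuc i) ≡ δ j i
    δ-suc i with j F.≟ i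
    ... | yes refl = refl
    ... | no _     = refl
    rearrange : ∀ x p y → p * (x * y) ≡ x * (p * y)
    rearrange = solve-∀

  term≤V : ∀ {n} (u : Fin n → ℕ) i → u i ≤ V u
  term≤V u fzero    = m≤m+n _ _
  term≤V u (fsuc i) = ≤-trans (term≤V (λ i → u (fsuc i)) i) (≤-trans (m≤m+n _ (b * V (λ i → u (fsuc i)))) (m≤n+m _ (u fzero)))

  V-digit : ∀ n m → m < p ^ n → V {n} (λ i → digit p (toℕ i) m) ≡ m
  V-digit zero    m (s≤s z≤n) = refl
  V-digit (suc n) m lt = trans (cong (λ y → m % p + p * y) (V-digit n (m / p) (shift< n m lt))) (sym (split-digit m))

  V-full : ∀ n → suc (V {n} (λ _ → b)) ≡ p ^ n
  V-full zero    = refl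
  V-full (suc n) = trans (rearrange b (V {n} (λ _ → b))) (cong (p *_) (V-full n))
    where
    rearrange : ∀ b v → suc (b + suc b * v) ≡ suc b * suc v
    rearrange = solve-∀

  -- The vector of incoming carries with the cycle cut open: the carry `r` into the lowest digit is
  -- free, which permits induction on the length.
  shift : ∀ {n} → ℕ → (Fin (suc n) → ℕ) → Fin (suc n) → ℕ
  shift r σ fzero    = r
  shift r σ (fsuc i) = σ (inject₁ i)

  V-shift : ∀ n r (σ : Fin (suc n) → ℕ) → V (shift r σ) + p ^ suc n * σ (fromℕ n) ≡ r + p * V σ
  V-shift zero    r σ = rearrange r p (σ fzero)
    where
    rearrange : ∀ r p s → r + p * 0 + p * 1 * s ≡ r + p * (s + p * 0)
    rearrange = solve-∀
  V-shift (suc n) r σ = trans (cong (λ x → r + p * x + p * p ^ suc n * σ (fromℕ (suc n))) (V-cong same))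
    (trans (rearrange r p (V (shift (σ fzero) (λ i → σ (fsuc i)))) (p ^ suc n) (σ (fromℕ (suc n))))
      (cong (λ x → r + p * x) (V-shift n (σ fzero) (λ i → σ (fsuc i)))))
    where
    same : ∀ i → σ (inject₁ i) ≡ shift (σ fzero) (λ i → σ (fsuc i)) i
    same fzero    = refl
    same (fsuc i) = refl
    rearrange : ∀ r p v P s → r + p * v + p * P * s ≡ r + p * (v + P * s)
    rearrange = solve-∀

  -- Interior carries preserve the value. Only the cyclic one matters: it leaves the top with weight
  -- `p ^ f` and returns at the bottom with weight 1.
  carries⇒V : ∀ {E σ u} → Carries E σ u → V E + σ (fromℕ f′) ≡ V u + p ^ f * σ (fromℕ f′)
  carries⇒V {E} {σ} {u} c = lin-≡ _ _ (cong₂ _+_ sums (sym (V-shift f′ (σ (fromℕ f′)) σ)))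
    (rearrange p (V E) (V (shift (σ (fromℕ f′)) σ)) (V u) (V σ) (σ (fromℕ f′)) (p ^ f))
    where
    prev-shift : ∀ t → σ (prev t) ≡ shift (σ (fromℕ f′)) σ t
    prev-shift fzero    = refl
    prev-shift (fsuc t) = refl
    sums : V E + V (shift (σ (fromℕ f′)) σ) ≡ V u + p * V σ
    sums = trans (sym (V-+ E (shift (σ (fromℕ f′)) σ))) (trans (V-cong (λ t → trans (cong (E t +_) (sym (prev-shift t))) (c t)))
      (trans (V-+ u (λ t → p * σ t)) (cong (V u +_) (V-* p σ))))
    rearrange : ∀ p E S u v s q → E + s + (u + p * v + (S + q * s)) ≡ u + q * s + (E + S + (s + p * v))
    rearrange = solve-∀

  -- The carries are determined from the lowest digit upwards; the carry r into it must agree with the final one.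
  V⇒carries : ∀ n (E u : Fin (suc n) → ℕ) r c → (∀ i → u i < p) → r + V E ≡ V u + p ^ suc n * c →
    ∃[ σ ] ((∀ t → E t + shift r σ t ≡ u t + p * σ t) × σ (fromℕ n) ≡ c)
  V⇒carries zero E u r c u<p e = (λ _ → c) , (λ { fzero → trans (+-comm (E fzero) r) (lin-≡ _ _ e (rearrange r (E fzero) p (u fzero) c)) }) , refl
    where
    rearrange : ∀ r E p u c → r + E + (u + p * 0 + p * 1 * c) ≡ u + p * c + (r + (E + p * 0))
    rearrange = solve-∀
  V⇒carries (suc n) E u r c u<p e = let (σ , eqs , last) = V⇒carries n E₁ u₁ s c (λ i → u<p (fsuc i)) e₁ in extend σ , eqs′ σ eqs , last
    where
    E₁ u₁ : Fin (suc n) → ℕ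
    E₁ i = E (fsuc i)
    u₁ i = u (fsuc i)
    s = (r + E fzero) / p
    remainder : (r + E fzero) % p ≡ u fzero
    remainder = trans (sym ([m+kn]%n≡m%n (r + E fzero) (V E₁) p))
      (trans (cong (_% p) (trans (rearrange r (E fzero) (V E₁) p) (trans e (rearrange′ (u fzero) p (V u₁) (p ^ suc n) c)))) (low%p (u fzero) _ (u<p fzero)))
      where
      rearrange : ∀ r E v p → r + E + v * p ≡ r + (E + p * v)
      rearrange = solve-∀
      rearrange′ : ∀ u p v P c → u + p * v + p * P * c ≡ u + p * (v + P * c)
      rearrange′ = solve-∀
    divided : r + E fzero ≡ u fzero + p * s
    divided = trans (split-digit (r + E fzero)) (cong (_+ p * s) remainder)
    e₁ : s + V E₁ ≡ V u₁ + p ^ suc n * c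
    e₁ = *-cancelˡ-≡ _ _ p (lin-≡ _ _ (cong₂ _+_ e (sym divided)) (rearrange p r (E fzero) (V E₁) (u fzero) (V u₁) (p ^ suc n) c s))
      where
      rearrange : ∀ p r E v u w P c s → p * (s + v) + (u + p * w + p * P * c + (r + E)) ≡ p * (w + P * c) + (r + (E + p * v) + (u + p * s))
      rearrange = solve-∀
    extend : (Fin (suc n) → ℕ) → Fin (suc (suc n)) → ℕ
    extend σ fzero    = s
    extend σ (fsuc i) = σ i
    eqs′ : ∀ σ → (∀ t → E₁ t + shift s σ t ≡ u₁ t + p * σ t) → ∀ t → E t + shift r (extend σ) t ≡ u t + p * extend σ t
    eqs′ σ eqs fzero           = trans (+-comm (E fzero) r) divided
    eqs′ σ eqs (fsuc fzero)    = eqs fzero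
    eqs′ σ eqs (fsuc (fsuc i)) = eqs (fsuc i)

  q-1 : ℕ
  q-1 = p ^ f ∸ 1

  suc-q-1 : suc q-1 ≡ p ^ f
  suc-q-1 = m+[n∸m]≡n (m^n>0 p f)

  q-1>0 : 0 < q-1
  q-1>0 = m<n⇒0<n∸m (≤-trans 1<p (≤-trans (≤-reflexive (sym (*-identityʳ p))) (*-monoʳ-≤ p (m^n>0 p f′))))

  -- A surplus of `c * q-1` is a carry `c` that leaves at the top and enters at the bottom.
  find-carries : ∀ E (u : T → ℕ) c → (∀ t → u t < p) → V E ≡ V u + c * q-1 → ∃[ σ ] Carries E σ u
  find-carries E u c u<p e with V⇒carries f′ E u c c u<p (trans (trans (cong (c +_) e) (rearrange c (V u) q-1)) (cong (λ q → V u + q * c) suc-q-1))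
    where
    rearrange : ∀ c u q → c + (u + c * q) ≡ u + suc q * c
    rearrange = solve-∀
  ... | σ , eqs , last = σ , eqs′
    where
    eqs′ : Carries E σ u
    eqs′ fzero    = trans (cong (E fzero +_) last) (eqs fzero)
    eqs′ (fsuc t) = eqs (fsuc t)

  -- `p ^ f` is 1 modulo `q-1`.
  power-residue : ∀ n → ∃[ c ] p ^ n ≡ p ^ toℕ (ty n) + c * q-1
  power-residue n = let (c , e) = residue (n / f) in p ^ toℕ (ty n) * c ,
    trans (cong (p ^_) (trans (m≡m%n+[m/n]*n n f) (cong (λ x → n % f + x) (*-comm (n / f) f))))
      (trans (^-distribˡ-+-* p (n % f) (f * (n / f))) (trans (cong₂ _*_ (cong (p ^_) (sym (FP.toℕ-fromℕ< (m%n<n n f)))) (trans (sym (^-*-assoc p f (n / f))) e)) (rearrange (p ^ toℕ (ty n)) c q-1)))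
    where
    rearrange : ∀ a c q → a * suc (c * q) ≡ a + a * c * q
    rearrange = solve-∀
    residue : ∀ k → ∃[ c ] (p ^ f) ^ k ≡ suc (c * q-1)
    residue zero    = 0 , refl
    residue (suc k) with residue k
    ... | c , e = suc (c + c * q-1) , trans (cong₂ _*_ (sym suc-q-1) e) (rearrange′ q-1 c)
      where
      rearrange′ : ∀ q c → suc q * suc (c * q) ≡ suc (suc (c + c * q) * q)
      rearrange′ = solve-∀

  val-residue : ∀ N a → ∃[ c ] val N a ≡ V (cnt N a) + c * q-1
  val-residue zero    a = 0 , sym (trans (+-identityʳ _) (V-0 {f} (λ _ → refl)))
  val-residue (suc B) a with val-residue B a | power-residue B
  ... | c , e | c′ , e′ = c + a B * c′ , trans (cong₂ (λ x y → x + a B * y) e e′)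
    (trans (rearrange (V (cnt B a)) c q-1 (a B) (p ^ toℕ (ty B)) c′)
      (cong (_+ (c + a B * c′) * q-1) (sym (trans (V-+ (cnt B a) (λ t → δ (ty B) t * a B)) (cong (V (cnt B a) +_) (V-δ (ty B) (a B)))))))
    where
    rearrange : ∀ v c q a P c′ → v + c * q + a * (P + c′ * q) ≡ v + a * P + (c + a * c′) * q
    rearrange = solve-∀

  V-pos : ∀ N a → 0 < val N a → 0 < V (cnt N a)
  V-pos N a pos with sumTo-pos N (λ n → a n * p ^ n) pos
  ... | n , n<N , term>0 = ≤-trans (≤-trans a>0 (≤-trans (≤-reflexive (trans (sym (+-identityʳ (a n))) (cong (_* a n) (sym (δ-refl (ty n))))))
          (term≤sumTo N (λ l → δ (ty l) (ty n) * a l) n<N))) (term≤V (cnt N a) (ty n))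
    where
    a>0 : 0 < a n
    a>0 = n≢0⇒n>0 (λ e → contradiction (cong (_* p ^ n) e) (>⇒≢ term>0))

  -- The full vector has value `q-1`, so a coin vector of value `suc x * q-1` reduces to it with
  -- cyclic carry `x`. Positivity excludes the multiple 0.
  even⇒carries : ∀ N a → 0 < val N a → q-1 ∣ val N a → ∃[ σ ] Carries (cnt N a) σ (λ _ → b)
  even⇒carries N a pos even with val-residue N a
  ... | c , e with ∣m+n∣m⇒∣n (subst (q-1 ∣_) (trans e (+-comm _ (c * q-1))) even) (n∣m*n c)
  ...   | divides zero    e′ = contradiction e′ (>⇒≢ (V-pos N a pos))
  ...   | divides (suc x) e′ = find-carries (cnt N a) (λ _ → b) x (λ _ → ≤-refl) (trans e′ (cong (_+ x * q-1) (suc-injective (trans suc-q-1 (sym (V-full f))))))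

  -- The full digits contribute one `q-1` and the cyclic carry `s` contributes `s` more, so the
  -- multiple is never 0.
  carries⇒even : ∀ N a {σ} → Carries (cnt N a) σ (λ _ → b) → 0 < val N a × q-1 ∣ val N a
  carries⇒even N a {σ} c = ≤-trans (≤-trans q-1>0 (≤-trans (m≤m+n q-1 (s * q-1)) (≤-reflexive (sym V≡)))) (≤-trans (m≤m+n _ (c′ * q-1)) (≤-reflexive (sym e))) ,
      subst (q-1 ∣_) (sym e) (∣m∣n⇒∣m+n (divides (suc s) V≡) (n∣m*n c′))
    where
    s = σ (fromℕ f′)
    c′ = proj₁ (val-residue N a)
    e = proj₂ (val-residue N a)
    V≡ : V (cnt N a) ≡ suc s * q-1
    V≡ = +-cancelʳ-≡ s _ _ (trans (carries⇒V {u = λ _ → b} c) (trans (cong₂ (λ x y → x + y * s) (suc-injective (trans (V-full f) (sym suc-q-1))) (sym suc-q-1)) (rearrange q-1 s)))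
      where
      rearrange : ∀ q s → q + suc q * s ≡ suc s * q + s
      rearrange = solve-∀

  -- For level 0: the coin vector reduces to the digits of the residue of `k`, with the quotient of
  -- its value by `q-1` as cyclic carry.
  residue⇒carries : ∀ N a k z → k ≡ val N a + z * q-1 → ∃[ σ ] Carries (cnt N a) σ (λ t → digit p (toℕ t) (_%_ k q-1 ⦃ >-nonZero q-1>0 ⦄))
  residue⇒carries N a k z e = find-carries (cnt N a) _ (V (cnt N a) / q-1) (λ t → digit<p (toℕ t) _)
    (trans (m≡m%n+[m/n]*n (V (cnt N a)) q-1) (cong (_+ (V (cnt N a) / q-1) * q-1) (sym (trans (V-digit f (k % q-1) r<q) same))))
    where
    instance _ = >-nonZero q-1>0
    r<q : k % q-1 < p ^ f
    r<q = <-trans (m%n<n k q-1) (≤-reflexive suc-q-1)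
    c = proj₁ (val-residue N a)
    same : k % q-1 ≡ V (cnt N a) % q-1
    same = trans (cong (_% q-1) (trans e (trans (cong (_+ z * q-1) (proj₂ (val-residue N a))) (rearrange (V (cnt N a)) c q-1 z)))) ([m+kn]%n≡m%n (V (cnt N a)) (c + z) q-1)
      where
      rearrange : ∀ v c q z → v + c * q + z * q ≡ v + (c + z) * q
      rearrange = solve-∀

-- Transfer to U_d(k) and minimality of the modest element.

module Minimality (b : ℕ) (1<p : 1 < suc b) (f′ : ℕ) (d k : ℕ) where
  open Digits b 1<p
  open Levels b 1<p f′ d
  open Compare p 1<p f′ ty D

  q : ℕ
  q = p ^ f

  k<p^k : k < p ^ k
  k<p^k = n<p^n 1<p k

  digits : Vec ℕ D → ℕ → ℕ → ℕ
  digits m g n = digit p n (at m g)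

  -- Level 0 need only have the right residue modulo q ∸ 1; the others are positive multiples of q ∸ 1.
  target : ℕ → T → ℕ
  target zero    t = digit p (toℕ t) (_%_ k q-1 ⦃ >-nonZero q-1>0 ⦄)
  target (suc g) t = b

  tot : T → ℕ
  tot = cnt k (λ n → digit p n k)

  -- Before any coin is dealt, every digit of the levels from 1 on is full.
  ordered : Ordered target tot
  ordered {suc g} t 1≤g g<g′ g′<D = inj₁ refl

  val-columns : ∀ N A → sumTo D (λ g → val N (A g)) ≡ val N (column D A)
  val-columns N A = trans (sumTo-comm D N (λ g n → A g n * p ^ n)) (sumTo-cong N (λ n _ → sumTo-*ʳ D (p ^ n) (λ g → A g n)))

  cnt-columns : ∀ N A t → sumTo D (λ g → cnt N (A g) t) ≡ cnt N (column D A) t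
  cnt-columns N A t = trans (sumTo-comm D N (λ g n → δ (ty n) t * A g n)) (sumTo-cong N (λ n _ → sumTo-* D (δ (ty n) t) (λ g → A g n)))

  module _ (m : Vec ℕ D) (m∈U : InU p q d k m) where

    sum≡k : sumTo D (at m) ≡ k
    sum≡k = trans (sym (sum-at m)) (proj₁ (proj₁ m∈U))

    column-digits : ∀ n → column D (digits m) n ≡ digit p n k
    column-digits n = trans (sym (sum-map-at (digit p n) m)) (proj₂ (proj₁ m∈U) n)

    at<p^k : ∀ g → g < D → at m g < p ^ k
    at<p^k g g<D = ≤-<-trans (≤-trans (term≤sumTo D (at m) g<D) (≤-reflexive sum≡k)) k<p^k

    val-digits : ∀ g → g < D → val k (digits m g) ≡ at m g
    val-digits g g<D = val-digit k (at m g) (at<p^k g g<D)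

    upper : ∀ g → g < d → 0 < at m (suc g) × q-1 ∣ at m (suc g)
    upper g g<d = subst (λ x → 0 < x × q-1 ∣ x)
      (trans (sym (at-lookup m (fsuc (F.fromℕ< g<d)))) (cong (λ l → at m (suc l)) (FP.toℕ-fromℕ< g<d))) (proj₂ m∈U (F.fromℕ< g<d))

    multiples : ∀ n → n ≤ d → ∃[ z ] sumTo (suc n) (at m) ≡ at m 0 + z * q-1
    multiples zero    _   = 0 , +-comm 0 (at m 0)
    multiples (suc n) n<d with multiples n (<⇒≤ n<d) | proj₂ (upper n n<d)
    ... | z , e | divides y e′ = z + y , trans (cong₂ _+_ e e′) (rearrange (at m 0) z q-1 y)
      where
      rearrange : ∀ a z q y → a + z * q + y * q ≡ a + (z + y) * q
      rearrange = solve-∀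

    level-carries : ∀ g → g < D → ∃[ σ ] Carries (cnt k (digits m g)) σ (target g)
    level-carries zero 0<D with multiples d ≤-refl
    ... | z , e = residue⇒carries k (digits m 0) k z (trans (sym sum≡k) (trans e (cong (_+ z * q-1) (sym (val-digits 0 0<D)))))
    level-carries (suc g) g<D = even⇒carries k (digits m (suc g)) (subst (0 <_) (sym (val-digits (suc g) g<D)) (proj₁ (upper g (s≤s⁻¹ g<D))))
      (subst (q-1 ∣_) (sym (val-digits (suc g) g<D)) (proj₂ (upper g (s≤s⁻¹ g<D))))

    carriers : ℕ → T → ℕ
    carriers g with g <? D
    ... | yes g<D = proj₁ (level-carries g g<D)
    ... | no _    = λ _ → 0

    carriers-valid : Valid D k target (digits m) carriers
    carriers-valid g g<D with g <? D
    ... | yes g<D′ = proj₂ (level-carries g g<D′)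
    ... | no g≮D   = contradiction g<D g≮D

    configuration : Configuration k target tot (digits m) carriers
    configuration = record
      { valid = carriers-valid
      ; vanishing = λ g n g<D k≤n → digit-beyond k n (at m g) (at<p^k g g<D) k≤n
      ; columns<p = λ n → subst (_< p) (sym (column-digits n)) (digit<p n k)
      ; totals = λ t → trans (cnt-columns k (digits m) t) (cnt-cong k (λ n _ → column-digits n) t) }

    tdeg-Φ : tdeg d m ≡ Φ D k (digits m)
    tdeg-Φ = trans (tdeg-at d m) (sumTo-cong D (λ g g<D → cong ((d ∸ g) *_) (sym (val-digits g g<D))))

    -- As the columns stay below `p`, the coins of the improved configuration are again base-p
    -- digits. Conserved columns then mean an addition without carry, and `carries⇒even` gives back
    -- the conditions on the parts.
    improve : Improvement D k target (digits m) → ∃[ m′ ] (InU p q d k m′ × tdeg d m′ < tdeg d m × reverse m <lex reverse m′)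
    improve imp = m′ , ((sum≡ , digits≡) , parts) , fewer , reverse-<lex m m′ I.h bigger above
      where
      module I = Improvement imp
      m′ : Vec ℕ D
      m′ = toVec D (λ g → val k (I.A′ g))
      at-m′ : ∀ g → g < D → at m′ g ≡ val k (I.A′ g)
      at-m′ g g<D = at-toVec D (λ g → val k (I.A′ g)) g g<D
      A′<p : ∀ g → g < D → ∀ n → I.A′ g n < p
      A′<p g g<D n = ≤-<-trans (term≤sumTo D (λ l → I.A′ l n) g<D) (subst (_< p) (sym (trans (I.columns n) (column-digits n))) (digit<p n k))
      digit-m′ : ∀ g → g < D → ∀ n → digit p n (at m′ g) ≡ I.A′ g n
      digit-m′ g g<D n = trans (cong (digit p n) (at-m′ g g<D)) (digit-val k (I.A′ g) (A′<p g g<D) (λ n k≤n → I.vanishing g n g<D k≤n) n)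
      sum≡ : sum m′ ≡ k
      sum≡ = trans (sum-toVec D (λ g → val k (I.A′ g))) (trans (val-columns k I.A′) (trans (val-cong k (λ n _ → I.columns n))
        (trans (sym (val-columns k (digits m))) (trans (sumTo-cong D val-digits) sum≡k))))
      digits≡ : ∀ n → sum (Vec.map (digit p n) m′) ≡ digit p n k
      digits≡ n = trans (sum-map-at (digit p n) m′) (trans (sumTo-cong D (λ g g<D → digit-m′ g g<D n)) (trans (I.columns n) (column-digits n)))
      parts : ∀ i → 0 < lookup m′ (fsuc i) × QEven q (lookup m′ (fsuc i))
      parts i = subst (λ x → 0 < x × q-1 ∣ x) (trans (sym (at-m′ (toℕ (fsuc i)) i<D)) (at-lookup m′ (fsuc i)))
        (carries⇒even k (I.A′ (toℕ (fsuc i))) (I.valid (toℕ (fsuc i)) i<D))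
        where
        i<D : toℕ (fsuc i) < D
        i<D = FP.toℕ<n (fsuc i)
      fewer : tdeg d m′ < tdeg d m
      fewer = subst₂ _<_ (sym (trans (tdeg-at d m′) (sumTo-cong D (λ g g<D → cong ((d ∸ g) *_) (at-m′ g g<D))))) (sym tdeg-Φ) I.cheaper
      bigger : at m I.h < at m′ I.h
      bigger = subst₂ _<_ (val-digits I.h I.h<D) (sym (at-m′ I.h I.h<D)) I.larger
      above : ∀ g → I.h < g → g < D → at m g ≡ at m′ g
      above g h<g g<D = trans (sym (val-digits g g<D)) (trans (val-cong k (λ n _ → sym (I.above g n h<g))) (sym (at-m′ g g<D)))

  modest-minimal : ∀ {M} → Modest p q d k M → ∀ {m} → InU p q d k m → ¬ (m ≡ M) → tdeg d M < tdeg d m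
  modest-minimal {M} (M∈U , greatest) {m} m∈U m≢M = descend m m∈U m≢M (<-wellFounded _)
    where
    descend : ∀ m → InU p q d k m → ¬ (m ≡ M) → Acc _<_ (tdeg d m) → tdeg d M < tdeg d m
    descend m m∈U m≢M (acc rec)
      with comparison k ordered (configuration m m∈U) (configuration M M∈U) (λ n → trans (column-digits m m∈U n) (sym (column-digits M M∈U n)))
    ... | inj₂ (inj₂ same) = contradiction (at-ext m M λ g g<D →
            trans (sym (val-digits m m∈U g g<D)) (trans (val-cong k (λ n _ → same g n g<D)) (val-digits M M∈U g g<D))) m≢M
    -- An improvement of `M` would have a larger reverse.
    ... | inj₂ (inj₁ imp) = let (m′ , m′∈U , _ , lex) = improve M M∈U imp in contradiction lex (greatest m′ m′∈U)
    ... | inj₁ imp with improve m m∈U imp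
    ...   | m′ , m′∈U , fewer , _ with VecP.≡-dec _≟_ m′ M
    ...     | yes refl  = fewer
    ...     | no m′≢M   = <-trans (descend m′ m′∈U m′≢M (rec fewer)) fewer

theorem2p8 : (p f q : ℕ) → Prime p → 0 < f → q ≡ p ^ f →
    (k d : ℕ) → 0 < k →
    (M : Vec ℕ (suc d)) → Modest p q d k M →
    (m : Vec ℕ (suc d)) → InU p q d k m → ¬ (m ≡ M) →
    tdeg d M < tdeg d m
theorem2p8 zero          f        q p-prime 0<f = contradiction p-prime ¬prime[0]
theorem2p8 (suc zero)    f        q p-prime 0<f = contradiction p-prime ¬prime[1]
theorem2p8 (suc (suc b)) (suc f′) q p-prime 0<f refl k d 0<k M modest m m∈U m≢M =
  Minimality.modest-minimal (suc b) (s≤s (s≤s z≤n)) f′ d k {M} modest {m} m∈U m≢M
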